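{- Given a cograph $G$ with $n$ vertices and $m$ edges, an integer well-covering system of $G$ with size at most $n-1$ can be computed in time $\mathcal{O}(n(n+m))$.
   Context: All graphs are finite, simple, and undirected. A cograph is a graph that can be constructed from copies of the one-vertex graph using the operations of disjoint union and complementation. An independent set is a set of pairwise nonadjacent vertices; it is maximal if it is not contained in any larger independent set. A weight function $w:V(G)\to\mathbb{R}$ is a well-covered weighting of $G$ if all maximal independent sets $I$ of $G$ have the same weight $w(I)=\sum_{v\in I}w(v)$. A well-covering system of $G$ is a system $\mathcal{S}$ of homogeneous linear equations with real coefficients over the variables $\{x_v: v\in V(G)\}$ such that $w:V(G)\to\mathbb{R}$ is a well-covered weighting of $G$ if and only if setting $x_v=w(v)$ for all $v\in V(G)$ satisfies all equations of $\mathcal{S}$. Its size is its number of equations. It is integer if all its coefficients are integers. -}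

module Defs where

open import Level using (0ℓ)
open import Data.Bool.Base using (if_then_else_)
open import Data.Nat.Base as ℕ using (ℕ; zero; suc)
import Data.Nat.Properties as ℕ
open import Data.Integer.Base as ℤ using (ℤ)
open import Data.Rational.Base as ℚ using (ℚ; 0ℚ; 1ℚ; ½)
import Data.Rational.Properties as ℚ
open import Data.Rational.Solver using (module +-*-Solver)
open import Data.Fin.Base as Fin using (Fin; toℕ; splitAt)
import Data.Fin.Properties as Fin
open import Data.Fin.Permutation using (Permutation′; _⟨$⟩ʳ_)
open import Data.Fin.Subset as Subset using (Subset)
open import Data.List.Base as List
  using (List; []; _∷_; _++_; length; map; concatMap; allFin; cartesianProduct; filter)
open import Data.List.Membership.Propositional using (_∈_)
open import Data.List.Relation.Unary.All using (All)
open import Data.List.Relation.Unary.Unique.Propositional using (Unique)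
open import Data.Vec.Base as Vec using (Vec)
open import Data.Product.Base using (_×_; _,_; ∃; ∃-syntax; proj₁; proj₂)
open import Data.Sum.Relation.Binary.Pointwise as Sum using (Pointwise)
open import Function.Bundles using (_⇔_)
open import Relation.Binary.Core using (Rel)
open import Relation.Binary.Definitions using (Decidable; Symmetric)
open import Relation.Binary.PropositionalEquality
  using (_≡_; _≢_; refl; sym; trans; cong; subst)
open import Relation.Nullary using (¬_)
open import Relation.Nullary.Decidable using (does; ¬?; _×-dec_)
open import Algebra.Bundles.Raw using (RawMonoid)
import Algebra.Definitions.RawMonoid as RawMonoidDefs

------------------------------------------------------------------------
-- Real numbers: Cauchy sequences of rationals, as a setoid

IsCauchy : (ℕ → ℚ) → Set
IsCauchy x = ∀ ε → 0ℚ ℚ.< ε →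
  ∃[ N ] (∀ i j → N ℕ.≤ i → N ℕ.≤ j → ℚ.∣ x i ℚ.- x j ∣ ℚ.< ε)

record ℝ : Set where
  constructor mkℝ
  field
    seq    : ℕ → ℚ
    cauchy : IsCauchy seq

open ℝ public

infix 4 _≈_

_≈_ : Rel ℝ 0ℓ
x ≈ y = ∀ ε → 0ℚ ℚ.< ε →
  ∃[ N ] (∀ i → N ℕ.≤ i → ℚ.∣ seq x i ℚ.- seq y i ∣ ℚ.< ε)

private
  ½-pos : ∀ {ε} → 0ℚ ℚ.< ε → 0ℚ ℚ.< ½ ℚ.* ε
  ½-pos {ε} 0<ε = ℚ.positive⁻¹ _ {{ℚ.pos*pos⇒pos ½ ε {{ℚ.positive 0<ε}}}}

  ½+½ : ∀ ε → ½ ℚ.* ε ℚ.+ ½ ℚ.* ε ≡ ε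
  ½+½ ε = trans (sym (ℚ.*-distribʳ-+ ε ½ ½)) (ℚ.*-identityˡ ε)

constant-cauchy : ∀ q → IsCauchy (λ _ → q)
constant-cauchy q ε 0<ε =
  0 , λ _ _ _ _ → subst (λ r → ℚ.∣ r ∣ ℚ.< ε) (sym (ℚ.+-inverseʳ q)) 0<ε

+-cauchy : ∀ {x y} → IsCauchy x → IsCauchy y → IsCauchy (λ i → x i ℚ.+ y i)
+-cauchy {x} {y} cx cy ε 0<ε with cx (½ ℚ.* ε) (½-pos 0<ε) | cy (½ ℚ.* ε) (½-pos 0<ε)
... | M , hx | N , hy = M ℕ.⊔ N , λ i j i≥ j≥ → begin-strict
  ℚ.∣ (x i ℚ.+ y i) ℚ.- (x j ℚ.+ y j) ∣
    ≡⟨ cong ℚ.∣_∣ (rearrange (x i) (y i) (x j) (y j)) ⟩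
  ℚ.∣ (x i ℚ.- x j) ℚ.+ (y i ℚ.- y j) ∣
    ≤⟨ ℚ.∣p+q∣≤∣p∣+∣q∣ (x i ℚ.- x j) (y i ℚ.- y j) ⟩
  ℚ.∣ x i ℚ.- x j ∣ ℚ.+ ℚ.∣ y i ℚ.- y j ∣
    <⟨ ℚ.+-mono-< (hx i j (ℕ.m⊔n≤o⇒m≤o M N i≥) (ℕ.m⊔n≤o⇒m≤o M N j≥))
                  (hy i j (ℕ.m⊔n≤o⇒n≤o M N i≥) (ℕ.m⊔n≤o⇒n≤o M N j≥)) ⟩
  ½ ℚ.* ε ℚ.+ ½ ℚ.* ε
    ≡⟨ ½+½ ε ⟩
  ε ∎
  where
  open ℚ.≤-Reasoning
  rearrange : ∀ a b c d → (a ℚ.+ b) ℚ.- (c ℚ.+ d) ≡ (a ℚ.- c) ℚ.+ (b ℚ.- d)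
  rearrange = solve 4 (λ a b c d → (a :+ b) :- (c :+ d) := (a :- c) :+ (b :- d)) refl
    where open +-*-Solver

eventually-bounded : ∀ {x} → IsCauchy x →
  ∃[ B ] (0ℚ ℚ.< B × ∃[ N ] (∀ i → N ℕ.≤ i → ℚ.∣ x i ∣ ℚ.< B))
eventually-bounded {x} cx with cx 1ℚ (ℚ.positive⁻¹ 1ℚ)
... | N , h = 1ℚ ℚ.+ ℚ.∣ x N ∣
            , ℚ.+-mono-<-≤ (ℚ.positive⁻¹ 1ℚ) (ℚ.0≤∣p∣ (x N))
            , N , λ i i≥ → begin-strict
  ℚ.∣ x i ∣                           ≡⟨ cong ℚ.∣_∣ (split (x i) (x N)) ⟩
  ℚ.∣ (x i ℚ.- x N) ℚ.+ x N ∣         ≤⟨ ℚ.∣p+q∣≤∣p∣+∣q∣ (x i ℚ.- x N) (x N) ⟩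
  ℚ.∣ x i ℚ.- x N ∣ ℚ.+ ℚ.∣ x N ∣     <⟨ ℚ.+-monoˡ-< ℚ.∣ x N ∣ (h i N i≥ ℕ.≤-refl) ⟩
  1ℚ ℚ.+ ℚ.∣ x N ∣                    ∎
  where
  open ℚ.≤-Reasoning
  split : ∀ a b → a ≡ (a ℚ.- b) ℚ.+ b
  split = solve 2 (λ a b → a := (a :- b) :+ b) refl
    where open +-*-Solver

private
  product-< : ∀ p q r s → 0ℚ ℚ.< r → ℚ.∣ p ∣ ℚ.< r → ℚ.∣ q ∣ ℚ.< s →
              ℚ.∣ p ℚ.* q ∣ ℚ.< r ℚ.* s
  product-< p q r s 0<r p<r q<s = begin-strict
    ℚ.∣ p ℚ.* q ∣         ≡⟨ ℚ.∣p*q∣≡∣p∣*∣q∣ p q ⟩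
    ℚ.∣ p ∣ ℚ.* ℚ.∣ q ∣   ≤⟨ ℚ.*-monoʳ-≤-nonNeg ℚ.∣ q ∣ {{ℚ.nonNegative (ℚ.0≤∣p∣ q)}} (ℚ.<⇒≤ p<r) ⟩
    r ℚ.* ℚ.∣ q ∣         <⟨ ℚ.*-monoʳ-<-pos r {{ℚ.positive 0<r}} q<s ⟩
    r ℚ.* s               ∎
    where open ℚ.≤-Reasoning

  *-difference-< : ∀ A B δ a b c d → 0ℚ ℚ.< A → 0ℚ ℚ.< δ →
                   ℚ.∣ a ∣ ℚ.< A → ℚ.∣ d ∣ ℚ.< B →
                   ℚ.∣ a ℚ.- c ∣ ℚ.< δ → ℚ.∣ b ℚ.- d ∣ ℚ.< δ →
                   ℚ.∣ a ℚ.* b ℚ.- c ℚ.* d ∣ ℚ.< (A ℚ.+ B) ℚ.* δ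
  *-difference-< A B δ a b c d 0<A 0<δ a<A d<B ac<δ bd<δ = begin-strict
    ℚ.∣ a ℚ.* b ℚ.- c ℚ.* d ∣
      ≡⟨ cong ℚ.∣_∣ (rearrange a b c d) ⟩
    ℚ.∣ a ℚ.* (b ℚ.- d) ℚ.+ (a ℚ.- c) ℚ.* d ∣
      ≤⟨ ℚ.∣p+q∣≤∣p∣+∣q∣ (a ℚ.* (b ℚ.- d)) ((a ℚ.- c) ℚ.* d) ⟩
    ℚ.∣ a ℚ.* (b ℚ.- d) ∣ ℚ.+ ℚ.∣ (a ℚ.- c) ℚ.* d ∣
      <⟨ ℚ.+-mono-< (product-< a (b ℚ.- d) A δ 0<A a<A bd<δ)
                    (product-< (a ℚ.- c) d δ B 0<δ ac<δ d<B) ⟩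
    A ℚ.* δ ℚ.+ δ ℚ.* B
      ≡⟨ collect A B δ ⟩
    (A ℚ.+ B) ℚ.* δ ∎
    where
    open ℚ.≤-Reasoning
    open +-*-Solver
    rearrange : ∀ a b c d → a ℚ.* b ℚ.- c ℚ.* d ≡ a ℚ.* (b ℚ.- d) ℚ.+ (a ℚ.- c) ℚ.* d
    rearrange = solve 4 (λ a b c d → a :* b :- c :* d := a :* (b :- d) :+ (a :- c) :* d) refl
    collect : ∀ a b e → a ℚ.* e ℚ.+ e ℚ.* b ≡ (a ℚ.+ b) ℚ.* e
    collect = solve 3 (λ a b e → a :* e :+ e :* b := (a :+ b) :* e) refl

  divide : ∀ C ε → 0ℚ ℚ.< C → 0ℚ ℚ.< ε → ∃[ δ ] (0ℚ ℚ.< δ × C ℚ.* δ ≡ ε)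
  divide C ε 0<C 0<ε =
      C⁻¹ ℚ.* ε
    , ℚ.positive⁻¹ (C⁻¹ ℚ.* ε)
        {{ℚ.pos*pos⇒pos C⁻¹ {{ℚ.1/pos⇒pos C {{ℚ.positive 0<C}}}} ε {{ℚ.positive 0<ε}}}}
    , trans (sym (ℚ.*-assoc C C⁻¹ ε))
        (trans (cong (ℚ._* ε) (ℚ.*-inverseʳ C {{C≢0}})) (ℚ.*-identityˡ ε))
    where
    C≢0 : ℚ.NonZero C
    C≢0 = ℚ.pos⇒nonZero C {{ℚ.positive 0<C}}
    C⁻¹ : ℚ
    C⁻¹ = (ℚ.1/ C) {{C≢0}}

*-cauchy : ∀ {x y} → IsCauchy x → IsCauchy y → IsCauchy (λ i → x i ℚ.* y i)
*-cauchy {x} {y} cx cy ε 0<ε =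
  let A , 0<A , K , hA = eventually-bounded {x} cx
      B , 0<B , L , hB = eventually-bounded {y} cy
      δ , 0<δ , Cδ≡ε   = divide (A ℚ.+ B) ε (ℚ.+-mono-< 0<A 0<B) 0<ε
      M , hx           = cx δ 0<δ
      N , hy           = cy δ 0<δ
  in (K ℕ.⊔ L) ℕ.⊔ (M ℕ.⊔ N) , λ i j i≥ j≥ →
    let i≥KL = ℕ.m⊔n≤o⇒m≤o (K ℕ.⊔ L) (M ℕ.⊔ N) i≥
        i≥MN = ℕ.m⊔n≤o⇒n≤o (K ℕ.⊔ L) (M ℕ.⊔ N) i≥
        j≥KL = ℕ.m⊔n≤o⇒m≤o (K ℕ.⊔ L) (M ℕ.⊔ N) j≥
        j≥MN = ℕ.m⊔n≤o⇒n≤o (K ℕ.⊔ L) (M ℕ.⊔ N) j≥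
    in subst (ℚ.∣ x i ℚ.* y i ℚ.- x j ℚ.* y j ∣ ℚ.<_) Cδ≡ε
         (*-difference-< A B δ (x i) (y i) (x j) (y j) 0<A 0<δ
           (hA i (ℕ.m⊔n≤o⇒m≤o K L i≥KL))
           (hB j (ℕ.m⊔n≤o⇒n≤o K L j≥KL))
           (hx i j (ℕ.m⊔n≤o⇒m≤o M N i≥MN) (ℕ.m⊔n≤o⇒m≤o M N j≥MN))
           (hy i j (ℕ.m⊔n≤o⇒n≤o M N i≥MN) (ℕ.m⊔n≤o⇒n≤o M N j≥MN)))

infixl 6 _+_
infixl 7 _*_

_+_ _*_ : ℝ → ℝ → ℝ
x + y = mkℝ (λ i → seq x i ℚ.+ seq y i) (+-cauchy {seq x} {seq y} (cauchy x) (cauchy y))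
x * y = mkℝ (λ i → seq x i ℚ.* seq y i) (*-cauchy {seq x} {seq y} (cauchy x) (cauchy y))

fromℤ : ℤ → ℝ
fromℤ z = mkℝ (λ _ → z ℚ./ 1) (constant-cauchy (z ℚ./ 1))

0ℝ : ℝ
0ℝ = fromℤ ℤ.0ℤ

+-0-rawMonoid : RawMonoid 0ℓ 0ℓ
+-0-rawMonoid = record { Carrier = ℝ ; _≈_ = _≈_ ; _∙_ = _+_ ; ε = 0ℝ }

open RawMonoidDefs +-0-rawMonoid public using (sum)

------------------------------------------------------------------------
-- Graphs with vertex set Fin n

record Graph (n : ℕ) : Set₁ where
  field
    Adj    : Rel (Fin n) 0ℓ
    adj?   : Decidable Adj
    symm   : Symmetric Adj
    irrefl : ∀ {v} → ¬ Adj v v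

open Graph public

∣E∣ : ∀ {n} → Graph n → ℕ
∣E∣ {n} G = length (filter (λ e → (proj₁ e Fin.<? proj₂ e) ×-dec adj? G (proj₁ e) (proj₂ e))
                           (cartesianProduct (allFin n) (allFin n)))

K₁ : Graph 1
K₁ = record
  { Adj    = λ u v → u ≢ v
  ; adj?   = λ u v → ¬? (u Fin.≟ v)
  ; symm   = λ u≢v v≡u → u≢v (sym v≡u)
  ; irrefl = λ v≢v → v≢v refl
  }

_⊎ᴳ_ : ∀ {m n} → Graph m → Graph n → Graph (m ℕ.+ n)
_⊎ᴳ_ {m} G H = record
  { Adj    = λ u v → Pointwise (Adj G) (Adj H) (splitAt m u) (splitAt m v)
  ; adj?   = λ u v → Sum.⊎-decidable (adj? G) (adj? H) (splitAt m u) (splitAt m v)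
  ; symm   = Sum.⊎-symmetric (symm G) (symm H)
  ; irrefl = Sum.⊎-irreflexive {≈₁ = _≡_} {≈₂ = _≡_}
               (λ { refl → irrefl G }) (λ { refl → irrefl H }) (Sum.⊎-refl refl refl)
  }

∁ᴳ : ∀ {n} → Graph n → Graph n
∁ᴳ G = record
  { Adj    = λ u v → u ≢ v × ¬ Adj G u v
  ; adj?   = λ u v → ¬? (u Fin.≟ v) ×-dec ¬? (adj? G u v)
  ; symm   = λ (u≢v , ¬uv) → (λ v≡u → u≢v (sym v≡u)) , (λ vu → ¬uv (symm G vu))
  ; irrefl = λ (v≢v , _) → v≢v refl
  }

_≅_ : ∀ {n} → Graph n → Graph n → Set
_≅_ {n} G H = ∃ λ (π : Permutation′ n) →
  ∀ u v → Adj G u v ⇔ Adj H (π ⟨$⟩ʳ u) (π ⟨$⟩ʳ v)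

data Construction : ℕ → Set where
  vertex     : Construction 1
  union      : ∀ {m n} → Construction m → Construction n → Construction (m ℕ.+ n)
  complement : ∀ {n} → Construction n → Construction n

⟦_⟧ : ∀ {n} → Construction n → Graph n
⟦ vertex ⟧       = K₁
⟦ union s t ⟧    = ⟦ s ⟧ ⊎ᴳ ⟦ t ⟧
⟦ complement t ⟧ = ∁ᴳ ⟦ t ⟧

IsCograph : ∀ {n} → Graph n → Set
IsCograph G = ∃[ t ] G ≅ ⟦ t ⟧

------------------------------------------------------------------------
-- Well-covered weightings and well-covering systems

Independent : ∀ {n} → Graph n → Subset n → Set
Independent G I = ∀ {u v} → u Subset.∈ I → v Subset.∈ I → ¬ Adj G u v

MaximalIndependent : ∀ {n} → Graph n → Subset n → Set
MaximalIndependent G I = Independent G I × (∀ J → Independent G J → ¬ (I Subset.⊂ J))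

weight : ∀ {n} → (Fin n → ℝ) → Subset n → ℝ
weight w I = sum (λ v → if Vec.lookup I v then w v else 0ℝ)

WellCovered : ∀ {n} → Graph n → (Fin n → ℝ) → Set
WellCovered G w =
  ∀ I J → MaximalIndependent G I → MaximalIndependent G J → weight w I ≈ weight w J

-- A homogeneous linear equation ∑ᵥ aᵥ xᵥ = 0 is given by its coefficients a.
Equation : ℕ → Set
Equation n = Fin n → ℝ

_Satisfies_ : ∀ {n} → (Fin n → ℝ) → Equation n → Set
x Satisfies a = sum (λ v → a v * x v) ≈ 0ℝ

WellCoveringSystem : ∀ {n} → Graph n → List (Equation n) → Set
WellCoveringSystem G S = ∀ w → WellCovered G w ⇔ All (w Satisfies_) S

IntegerSystem : ℕ → Set
IntegerSystem n = List (Vec ℤ n)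

toSystem : ∀ {n} → IntegerSystem n → List (Equation n)
toSystem = map (λ a v → fromℤ (Vec.lookup a v))

------------------------------------------------------------------------
-- Word RAM programs
--
-- A program is a structured command over registers and arrays of natural
-- numbers; registers and arrays are named by literals, so each program uses
-- only finitely many of them.  Every basic instruction and every test takes
-- one step.

data Op : Set where
  add sub mul : Op

⟦_⟧ᵒ : Op → ℕ → ℕ → ℕ
⟦ add ⟧ᵒ = ℕ._+_
⟦ sub ⟧ᵒ = ℕ._∸_
⟦ mul ⟧ᵒ = ℕ._*_

infixr 5 _⨾_

data Program : Set where
  skip   : Program
  const  : (r k : ℕ) → Program               -- r := k
  op     : Op → (r s t : ℕ) → Program        -- r := s ∘ t
  load   : (r a s : ℕ) → Program             -- r := a[s]
  store  : (a s t : ℕ) → Program             -- a[s] := t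
  print  : (r : ℕ) → Program
  _⨾_    : Program → Program → Program
  ifNZ   : (r : ℕ) → Program → Program → Program
  while  : (r : ℕ) → Program → Program

record State : Set where
  constructor mkState
  field
    reg : ℕ → ℕ
    arr : ℕ → ℕ → ℕ
    out : List ℕ

open State public

_[_↦_] : {A : Set} → (ℕ → A) → ℕ → A → ℕ → A
(f [ k ↦ a ]) j = if does (j ℕ.≟ k) then a else f j

setReg : ℕ → ℕ → State → State
setReg r x (mkState ρ μ o) = mkState (ρ [ r ↦ x ]) μ o

setArr : ℕ → ℕ → ℕ → State → State
setArr a i x (mkState ρ μ o) = mkState ρ (μ [ a ↦ μ a [ i ↦ x ] ]) o

emit : ℕ → State → State
emit x (mkState ρ μ o) = mkState ρ μ (o ++ x ∷ [])

-- Exec W p σ t τ : with words ranging over 0 … W-1, program p started in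
-- state σ halts in state τ after t steps.  A computation that would create a
-- number outside the word range has no derivation.  On graphs with n vertices
-- W will be a fixed power of n + 1, that is, words have O(log n) bits.
data Exec (W : ℕ) : Program → State → ℕ → State → Set where

  skip  : ∀ {σ} → Exec W skip σ 1 σ

  const : ∀ {σ r k} → k ℕ.< W → Exec W (const r k) σ 1 (setReg r k σ)

  op    : ∀ {σ ∘ r s t} → let x = ⟦ ∘ ⟧ᵒ (reg σ s) (reg σ t) in
          x ℕ.< W → Exec W (op ∘ r s t) σ 1 (setReg r x σ)

  load  : ∀ {σ r a s} → Exec W (load r a s) σ 1 (setReg r (arr σ a (reg σ s)) σ)

  store : ∀ {σ a s t} → Exec W (store a s t) σ 1 (setArr a (reg σ s) (reg σ t) σ)

  print : ∀ {σ r} → Exec W (print r) σ 1 (emit (reg σ r) σ)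

  _⨾_   : ∀ {p q σ τ υ t u} →
          Exec W p σ t τ → Exec W q τ u υ → Exec W (p ⨾ q) σ (t ℕ.+ u) υ

  ifNZ-true  : ∀ {r p q σ τ t} → reg σ r ≢ 0 →
               Exec W p σ t τ → Exec W (ifNZ r p q) σ (suc t) τ

  ifNZ-false : ∀ {r p q σ τ t} → reg σ r ≡ 0 →
               Exec W q σ t τ → Exec W (ifNZ r p q) σ (suc t) τ

  while-true  : ∀ {r p σ τ υ t u} → reg σ r ≢ 0 →
                Exec W p σ t τ → Exec W (while r p) τ u υ →
                Exec W (while r p) σ (suc (t ℕ.+ u)) υ

  while-false : ∀ {r p σ} → reg σ r ≡ 0 → Exec W (while r p) σ 1 σ

contents : List ℕ → ℕ → ℕ
contents []       _       = 0
contents (x ∷ xs) zero    = x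
contents (x ∷ xs) (suc i) = contents xs i

-- The input is the initial segment of array 0; everything else is zero.
initial : List ℕ → State
initial xs = mkState (λ _ → 0) ((λ _ _ → 0) [ 0 ↦ contents xs ]) []

------------------------------------------------------------------------
-- Input and output formats

-- Adjacency lists in which the neighbours are listed in an arbitrary order.
record AdjacencyLists {n} (G : Graph n) : Set where
  field
    nbrs    : Fin n → List (Fin n)
    unique  : ∀ v → Unique (nbrs v)
    correct : ∀ u v → v ∈ nbrs u ⇔ Adj G u v

open AdjacencyLists public

-- The number of vertices, then for each vertex its degree and its neighbours.
encodeGraph : ∀ {n} {G : Graph n} → AdjacencyLists G → List ℕ
encodeGraph {n} L =
  n ∷ concatMap (λ v → length (nbrs L v) ∷ map toℕ (nbrs L v)) (allFin n)

-- Sign (1 for negative) and absolute value.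
encodeℤ : ℤ → List ℕ
encodeℤ (ℤ.+ k)    = 0 ∷ k ∷ []
encodeℤ ℤ.-[1+ k ] = 1 ∷ suc k ∷ []

-- As n ≥ 1 is known from the input, the rows need no delimiters.
encodeSystem : ∀ {n} → IntegerSystem n → List ℕ
encodeSystem = concatMap (λ a → concatMap encodeℤ (Vec.toList a))

{-# OPTIONS --safe #-}

-- For a vertex v let I(v) be the maximal independent set obtained greedily
-- from {v} by scanning the vertices in index order.  In a cograph a weighting
-- w is well-covered as soon as w(I(v)) = w(I(0)) for all v, which gives the
-- n − 1 equations with coefficients in {−1, 0, 1}.  This goes by induction
-- along the cotree.  In a union of X and Y, the trace on Y of I(v) with v ∈ X
-- is the plain greedy set of Y, so it cancels in w(I(v)) = w(I(0)) and the
-- hypothesis restricts to X.  In a join, every maximal independent set lies in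
-- one side, and I(v) is the greedy set of the side of v.  A single scan takes
-- O(n + m) steps, so computing all I(v) takes O(n(n + m)).

module Submission where

open import Defs
open import Data.Nat.Base using (ℕ; suc; _∸_; _^_; _≤_) renaming (_+_ to _+ℕ_; _*_ to _*ℕ_)
open import Data.List.Base using (length)
open import Data.Product.Base using (_×_; ∃-syntax)
open import Relation.Binary.PropositionalEquality using (_≡_)

open import Data.Bool.Base using (Bool; true; false; if_then_else_; _∧_)
open import Data.Fin.Base as Fin using (Fin; zero; suc; toℕ; splitAt; _↑ˡ_; _↑ʳ_)
open import Data.Fin.Permutation using (_⟨$⟩ʳ_; _⟨$⟩ˡ_; inverseˡ; inverseʳ)
import Data.Fin.Properties as Fin
open import Data.Fin.Subset using (Subset; _∈_; _∉_; _⊆_; _∩_; _∪_; ⁅_⁆; ⊤; ⊥)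
open import Data.Fin.Subset.Properties
  using (∉⊥; ∈⊤; ⊆⊤; x∈⁅x⁆; x∈⁅y⁆⇒x≡y; ⊆-antisym; _∈?_;
         p∩q⊆p; p∩q⊆q; x∈p∩q⁺; p⊆p∪q; q⊆p∪q; x∈p∪q⁺; x∈p∪q⁻)
open import Data.Integer.Base as ℤ using (ℤ)
open import Data.List.Base as List
  using (List; []; _∷_; _++_; map; filter; allFin; cartesianProduct; concatMap; tabulate)
open import Data.List.Membership.Propositional using () renaming (_∈_ to _∈ˡ_)
open import Data.List.Membership.Propositional.Properties
  using (∈-∃++; ∈-++⁺ˡ; ∈-++⁺ʳ; ∈-++⁻; ∈-map⁺; ∈-map⁻; ∈-filter⁺; ∈-filter⁻; ∈-allFin; ∈-cartesianProduct⁺)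
import Data.List.Properties as List
open import Data.List.Relation.Unary.All as All using (All)
import Data.List.Relation.Unary.All.Properties as All
open import Data.List.Relation.Unary.AllPairs using (_∷_)
open import Data.List.Relation.Unary.Any using (here; there)
open import Data.List.Relation.Unary.Unique.Propositional using (Unique)
import Data.List.Relation.Unary.Unique.Propositional.Properties as Unique
open import Data.Nat.Base using (zero; _<_; s≤s; z≤n; >-nonZero)
open import Data.Nat.Induction using (<-wellFounded)
import Data.Nat.ListAction as ListAction
import Data.Nat.Properties as ℕ
open import Data.Nat.Solver renaming (module +-*-Solver to ℕ-Solver)
open import Data.Product.Base using (_,_; ∃; Σ-syntax; proj₁; proj₂; swap)
open import Data.Rational.Base as ℚ using (ℚ; 0ℚ; ½)
import Data.Rational.Properties as ℚ
open import Data.Rational.Solver using (module +-*-Solver)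
open import Data.Sum.Base as Sum using (_⊎_; inj₁; inj₂; [_,_]; [_,_]′)
open import Data.Sum.Relation.Binary.Pointwise as Pointwise using (inj₁; inj₂)
open import Data.Unit.Base as Unit using (tt)
import Data.Vec.Functional as Vector
open import Data.Vec.Base as Vec using (Vec; []; _∷_; lookup)
import Data.Vec.Properties as Vec
open import Function.Base using (_∘_; id; flip)
open import Function.Bundles using (_⇔_; mk⇔; Equivalence)
open import Function.Definitions using (Injective)
open import Induction.WellFounded using (Acc; acc)
open import Relation.Binary.Definitions using (tri<; tri≈; tri>)
open import Relation.Binary.PropositionalEquality
  using (_≢_; refl; sym; trans; cong; cong₂; subst; subst₂)
open import Relation.Nullary using (¬_; yes; no; contradiction)
open import Relation.Nullary.Decidable using (decidable-stable; dec-true; dec-false; ¬?; _×-dec_)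
open import Relation.Unary using (Decidable)

open Equivalence using (to; from)

-- The machine never sees a cotree: it scans in the index order of the input, and a cotree of `G`
-- serves only to show that the printed equations suffice. Its nodes are therefore subsets of the
-- fixed vertex set, so that the order at every node is the restriction of one global order. Since
-- `y ≺[ v ] x` differs from `y < x` only for `y = v`, the choice of `v` is invisible on a part
-- without `v`; this is what makes the traces cancel at a union. The delicate point is the reference
-- set. The induction compares all sets with the plain greedy set of the current node. At the root
-- this is I(0), because 0 is the least index. Below a join, I(0) may lie in the other side, and the
-- reference has to be replaced by another set of the family that is plain greedy on the side at
-- hand. No weight is ever computed by the program. Its numbers are bits, counters and positions in
-- the input or in an array of n² cells, hence polynomial in n.

-- Equality of real numbers

-- `x ≈ y` speaks only of the sequence of differences. Every rearrangement of weights below thus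
-- becomes a rational identity at a fixed index, with no new choice of bounds.
≈-by-difference : ∀ {x y x′ y′} →
  (∀ i → seq x i ℚ.- seq y i ≡ seq x′ i ℚ.- seq y′ i) → x ≈ y → x′ ≈ y′
≈-by-difference eq x≈y ε 0<ε with N , h ← x≈y ε 0<ε =
  N , λ i N≤i → subst (λ d → ℚ.∣ d ∣ ℚ.< ε) (eq i) (h i N≤i)

≈-reflexive : ∀ {x y} → x ≡ y → x ≈ y
≈-reflexive {x} refl ε 0<ε =
  0 , λ i _ → subst (λ d → ℚ.∣ d ∣ ℚ.< ε) (sym (ℚ.+-inverseʳ (seq x i))) 0<ε

≈-sym : ∀ {x y} → x ≈ y → y ≈ x
≈-sym {x} {y} x≈y ε 0<ε with N , h ← x≈y ε 0<ε =
  N , λ i N≤i → subst (ℚ._< ε) (flip-∣-∣ (seq x i) (seq y i)) (h i N≤i)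
  where
  open +-*-Solver
  flip-∣-∣ : ∀ a b → ℚ.∣ a ℚ.- b ∣ ≡ ℚ.∣ b ℚ.- a ∣
  flip-∣-∣ a b = trans (sym (ℚ.∣-p∣≡∣p∣ (a ℚ.- b)))
    (cong ℚ.∣_∣ (solve 2 (λ a b → :- (a :- b) := b :- a) refl a b))

private
  ½-positive : ∀ {ε} → 0ℚ ℚ.< ε → 0ℚ ℚ.< ½ ℚ.* ε
  ½-positive {ε} 0<ε = ℚ.positive⁻¹ _ {{ℚ.pos*pos⇒pos ½ ε {{ℚ.positive 0<ε}}}}

≈-trans : ∀ {x y z} → x ≈ y → y ≈ z → x ≈ z
≈-trans {x} {y} {z} x≈y y≈z ε 0<ε
  with M , h ← x≈y (½ ℚ.* ε) (½-positive 0<ε) | N , k ← y≈z (½ ℚ.* ε) (½-positive 0<ε) =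
  M +ℕ N , λ i M+N≤i → begin-strict
    ℚ.∣ seq x i ℚ.- seq z i ∣
      ≡⟨ cong ℚ.∣_∣ (insert (seq x i) (seq y i) (seq z i)) ⟩
    ℚ.∣ (seq x i ℚ.- seq y i) ℚ.+ (seq y i ℚ.- seq z i) ∣
      ≤⟨ ℚ.∣p+q∣≤∣p∣+∣q∣ (seq x i ℚ.- seq y i) (seq y i ℚ.- seq z i) ⟩
    ℚ.∣ seq x i ℚ.- seq y i ∣ ℚ.+ ℚ.∣ seq y i ℚ.- seq z i ∣
      <⟨ ℚ.+-mono-< (h i (ℕ.m+n≤o⇒m≤o M M+N≤i)) (k i (ℕ.m+n≤o⇒n≤o M M+N≤i)) ⟩
    ½ ℚ.* ε ℚ.+ ½ ℚ.* ε
      ≡⟨ trans (sym (ℚ.*-distribʳ-+ ε ½ ½)) (ℚ.*-identityˡ ε) ⟩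
    ε ∎
  where
  open ℚ.≤-Reasoning
  open +-*-Solver
  insert : ∀ a b c → a ℚ.- c ≡ (a ℚ.- b) ℚ.+ (b ℚ.- c)
  insert = solve 3 (λ a b c → a :- c := (a :- b) :+ (b :- c)) refl

-- Weights of sets and the equations comparing them

sum-additive : ∀ {n} i (f g h : Fin n → ℝ) →
  (∀ v → seq (f v) i ≡ seq (g v) i ℚ.+ seq (h v) i) →
  seq (sum f) i ≡ seq (sum g) i ℚ.+ seq (sum h) i
sum-additive {zero}  i f g h eq = refl
sum-additive {suc n} i f g h eq = trans
  (cong₂ ℚ._+_ (eq zero) (sum-additive i (f ∘ suc) (g ∘ suc) (h ∘ suc) (eq ∘ suc)))
  (interchange (seq (g zero) i) (seq (h zero) i) (seq (sum (g ∘ suc)) i) (seq (sum (h ∘ suc)) i))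
  where
  open +-*-Solver
  interchange : ∀ a b c d → (a ℚ.+ b) ℚ.+ (c ℚ.+ d) ≡ (a ℚ.+ c) ℚ.+ (b ℚ.+ d)
  interchange = solve 4 (λ a b c d → (a :+ b) :+ (c :+ d) := (a :+ c) :+ (b :+ d)) refl

coefficient : Bool → Bool → ℤ
coefficient true  false = ℤ.1ℤ
coefficient false true  = ℤ.-1ℤ
coefficient _     _     = ℤ.0ℤ

difference : ∀ {n} → Subset n → Subset n → Vec ℤ n
difference = Vec.zipWith coefficient

equation : ∀ {n} → Vec ℤ n → Equation n
equation a v = fromℤ (lookup a v)

module _ {n} (w : Fin n → ℝ) where

  weight-difference : ∀ I J i →
    seq (sum (λ v → equation (difference I J) v * w v)) i ≡ seq (weight w I) i ℚ.- seq (weight w J) i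
  -- Instead of subtracting under the sum, `weight w I` is written as the linear form plus
  -- `weight w J`, and the latter cancels.
  weight-difference I J i = trans (sym (cancel _ _)) (cong (ℚ._- seq (weight w J) i) (sym
    (sum-additive i (λ v → if lookup I v then w v else 0ℝ) (λ v → equation (difference I J) v * w v)
       (λ v → if lookup J v then w v else 0ℝ)
       (λ v → trans (pointwise (w v) (lookup I v) (lookup J v))
                (cong (λ a → seq (fromℤ a * w v) i ℚ.+ seq (if lookup J v then w v else 0ℝ) i)
                  (sym (Vec.lookup-zipWith coefficient v I J)))))))
    where
    open +-*-Solver
    cancel : ∀ a b → (a ℚ.+ b) ℚ.- b ≡ a
    cancel = solve 2 (λ a b → (a :+ b) :- b := a) refl
    pointwise : ∀ x b c → seq (if b then x else 0ℝ) i ≡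
      seq (fromℤ (coefficient b c) * x) i ℚ.+ seq (if c then x else 0ℝ) i
    pointwise x true  true  = solve 1 (λ a → a := con 0ℚ :* a :+ a) refl (seq x i)
    pointwise x true  false = solve 1 (λ a → a := con ℚ.1ℚ :* a :+ con 0ℚ) refl (seq x i)
    pointwise x false true  = solve 1 (λ a → con 0ℚ := (:- con ℚ.1ℚ) :* a :+ a) refl (seq x i)
    pointwise x false false = solve 1 (λ a → con 0ℚ := con 0ℚ :* a :+ con 0ℚ) refl (seq x i)

  satisfies-difference : ∀ I J → w Satisfies equation (difference I J) ⇔ weight w I ≈ weight w J
  satisfies-difference I J = mk⇔
    (≈-by-difference {Σa} {0ℝ} {weight w I} {weight w J} same)
    (≈-by-difference {weight w I} {weight w J} {Σa} {0ℝ} (sym ∘ same))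
    where
    Σa = sum (λ v → equation (difference I J) v * w v)
    same : ∀ i → seq Σa i ℚ.- 0ℚ ≡ seq (weight w I) i ℚ.- seq (weight w J) i
    same i = trans (ℚ.+-identityʳ _) (weight-difference I J i)

  weight-split : ∀ {C X Y : Subset n} → (∀ {v} → v ∈ C → v ∈ X ⊎ v ∈ Y) →
    (∀ {v} → v ∈ X → v ∉ Y) → ∀ i →
    seq (weight w C) i ≡ seq (weight w (C ∩ X)) i ℚ.+ seq (weight w (C ∩ Y)) i
  weight-split {C} {X} {Y} cover disjoint i = sum-additive i (λ v → if lookup C v then w v else 0ℝ)
    (λ v → if lookup (C ∩ X) v then w v else 0ℝ) (λ v → if lookup (C ∩ Y) v then w v else 0ℝ)
    λ v → subst₂ (λ b c → seq (if lookup C v then w v else 0ℝ) i ≡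
                    seq (if b then w v else 0ℝ) i ℚ.+ seq (if c then w v else 0ℝ) i)
            (sym (Vec.lookup-zipWith _∧_ v C X)) (sym (Vec.lookup-zipWith _∧_ v C Y))
            (pointwise (w v) (lookup C v) (lookup X v) (lookup Y v)
              (Sum.map Vec.[]=⇒lookup Vec.[]=⇒lookup ∘ cover ∘ Vec.lookup⇒[]= v C)
              (λ x y → disjoint (Vec.lookup⇒[]= v X x) (Vec.lookup⇒[]= v Y y)))
    where
    pointwise : ∀ x b c d → (b ≡ true → c ≡ true ⊎ d ≡ true) → (c ≡ true → d ≢ true) →
      seq (if b then x else 0ℝ) i ≡
        seq (if b ∧ c then x else 0ℝ) i ℚ.+ seq (if b ∧ d then x else 0ℝ) i
    pointwise x false c     d     _   _   = sym (ℚ.+-identityˡ 0ℚ)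
    pointwise x true  true  true  _   dis = contradiction refl (dis refl)
    pointwise x true  true  false _   _   = sym (ℚ.+-identityʳ (seq x i))
    pointwise x true  false true  _   _   = sym (ℚ.+-identityˡ (seq x i))
    pointwise x true  false false cov _ with cov refl
    ... | inj₁ ()
    ... | inj₂ ()

-- Cotrees on subsets of the vertex set

module _ {n} (G : Graph n) where

  -- Only `union` records disjointness; for `join` it follows from the irreflexivity of adjacency.
  data Cotree : Subset n → Set where
    leaf  : ∀ v → Cotree ⁅ v ⁆
    union : ∀ {X Y} → Cotree X → Cotree Y → (∀ {v} → v ∈ X → v ∉ Y) →
            (∀ {x y} → x ∈ X → y ∈ Y → ¬ Adj G x y) → Cotree (X ∪ Y)
    join  : ∀ {X Y} → Cotree X → Cotree Y →
            (∀ {x y} → x ∈ X → y ∈ Y → Adj G x y) → Cotree (X ∪ Y)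

-- Complementation exchanges union and join. The disjointness stored at a union is what turns a
-- missing edge of the complement into an edge of `G`.
∁-cotree : ∀ {n} (G : Graph n) {X} → Cotree (∁ᴳ G) X → Cotree G X
∁-cotree G (leaf v) = leaf v
∁-cotree G (union s t disjoint separate) = join (∁-cotree G s) (∁-cotree G t)
  λ {x} {y} x∈X y∈Y → decidable-stable (adj? G x y)
    λ ¬xy → separate x∈X y∈Y ((λ { refl → disjoint x∈X y∈Y }) , ¬xy)
∁-cotree G (join s t complete) = union (∁-cotree G s) (∁-cotree G t)
  (λ x∈X x∈Y → proj₁ (complete x∈X x∈Y) refl)
  (λ x∈X y∈Y → proj₂ (complete x∈X y∈Y))

record Image {k n} (f : Fin k → Fin n) (X : Subset n) : Set where
  field
    value    : ∀ i → f i ∈ X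
    preimage : ∀ {v} → v ∈ X → ∃[ i ] f i ≡ v

open Image

-- The graph built by `t` is placed into `G` along an embedding `f`, so that subterms can be treated
-- inside the same vertex set. At a complement, `f` is kept and `G` is complemented instead;
-- `∁-cotree` then brings the result back.
construction-cotree : ∀ {k n} (t : Construction k) (G : Graph n) (f : Fin k → Fin n) →
  Injective _≡_ _≡_ f → (∀ i j → Adj ⟦ t ⟧ i j ⇔ Adj G (f i) (f j)) →
  ∃[ X ] Cotree G X × Image f X
construction-cotree vertex G f inj iso = ⁅ f zero ⁆ , leaf (f zero) , record
  { value    = λ { zero → x∈⁅x⁆ (f zero) }
  ; preimage = λ v∈ → zero , sym (x∈⁅y⁆⇒x≡y (f zero) v∈)
  }
construction-cotree (union {k} {l} s t) G f inj iso =
  let X , S , imX = construction-cotree s G (f ∘ (_↑ˡ l)) (Fin.↑ˡ-injective l _ _ ∘ inj)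
        (λ i j → mk⇔ (to (iso (i ↑ˡ l) (j ↑ˡ l)) ∘ left⁺ i j) (left⁻ i j ∘ from (iso (i ↑ˡ l) (j ↑ˡ l))))
      Y , T , imY = construction-cotree t G (f ∘ (k ↑ʳ_)) (Fin.↑ʳ-injective k _ _ ∘ inj)
        (λ i j → mk⇔ (to (iso (k ↑ʳ i) (k ↑ʳ j)) ∘ right⁺ i j) (right⁻ i j ∘ from (iso (k ↑ʳ i) (k ↑ʳ j))))
  in X ∪ Y
   , union S T
       (λ x∈X x∈Y → let i , fi≡x = preimage imX x∈X
                        j , fj≡x = preimage imY x∈Y
                    in ↑ˡ≢↑ʳ i j (inj (trans fi≡x (sym fj≡x))))
       (λ x∈X y∈Y xy → let i , fi≡x = preimage imX x∈X
                           j , fj≡y = preimage imY y∈Y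
                       in apart i j (from (iso (i ↑ˡ l) (k ↑ʳ j)) (subst₂ (Adj G) (sym fi≡x) (sym fj≡y) xy)))
   , record
       { value    = λ i → subst (λ j → f j ∈ X ∪ Y) (Fin.join-splitAt k l i)
           ([_,_] {C = λ z → f (Fin.join k l z) ∈ X ∪ Y}
             (λ i → x∈p∪q⁺ (inj₁ (value imX i))) (λ j → x∈p∪q⁺ (inj₂ (value imY j))) (splitAt k i))
       ; preimage = λ v∈ → [ (λ v∈X → let i , eq = preimage imX v∈X in i ↑ˡ l , eq)
                           , (λ v∈Y → let j , eq = preimage imY v∈Y in k ↑ʳ j , eq)
                           ]′ (x∈p∪q⁻ X Y v∈)
       }
  where
  left⁺ : ∀ i j → Adj ⟦ s ⟧ i j → Adj ⟦ union s t ⟧ (i ↑ˡ l) (j ↑ˡ l)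
  left⁺ i j a rewrite Fin.splitAt-↑ˡ k i l | Fin.splitAt-↑ˡ k j l = inj₁ a
  left⁻ : ∀ i j → Adj ⟦ union s t ⟧ (i ↑ˡ l) (j ↑ˡ l) → Adj ⟦ s ⟧ i j
  left⁻ i j a rewrite Fin.splitAt-↑ˡ k i l | Fin.splitAt-↑ˡ k j l = Pointwise.drop-inj₁ a
  right⁺ : ∀ i j → Adj ⟦ t ⟧ i j → Adj ⟦ union s t ⟧ (k ↑ʳ i) (k ↑ʳ j)
  right⁺ i j a rewrite Fin.splitAt-↑ʳ k l i | Fin.splitAt-↑ʳ k l j = inj₂ a
  right⁻ : ∀ i j → Adj ⟦ union s t ⟧ (k ↑ʳ i) (k ↑ʳ j) → Adj ⟦ t ⟧ i j
  right⁻ i j a rewrite Fin.splitAt-↑ʳ k l i | Fin.splitAt-↑ʳ k l j = Pointwise.drop-inj₂ a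
  apart : ∀ i j → ¬ Adj ⟦ union s t ⟧ (i ↑ˡ l) (k ↑ʳ j)
  apart i j a rewrite Fin.splitAt-↑ˡ k i l | Fin.splitAt-↑ʳ k l j with () ← a
  ↑ˡ≢↑ʳ : ∀ i j → i ↑ˡ l ≢ k ↑ʳ j
  ↑ˡ≢↑ʳ i j eq with () ← trans (sym (Fin.splitAt-↑ˡ k i l)) (trans (cong (splitAt k) eq) (Fin.splitAt-↑ʳ k l j))
construction-cotree (complement t) G f inj iso =
  let X , T , im = construction-cotree t (∁ᴳ G) f inj (λ i j → mk⇔ (forth i j) (back i j))
  in X , ∁-cotree G T , im
  where
  forth : ∀ i j → Adj ⟦ t ⟧ i j → Adj (∁ᴳ G) (f i) (f j)
  forth i j a = (λ fi≡fj → irrefl ⟦ t ⟧ (subst (Adj ⟦ t ⟧ i) (sym (inj fi≡fj)) a))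
              , (λ b → proj₂ (from (iso i j) b) a)
  back : ∀ i j → Adj (∁ᴳ G) (f i) (f j) → Adj ⟦ t ⟧ i j
  back i j (fi≢fj , ¬b) = decidable-stable (adj? ⟦ t ⟧ i j)
    λ ¬a → ¬b (to (iso i j) ((λ i≡j → fi≢fj (cong f i≡j)) , ¬a))

cograph-cotree : ∀ {n} {G : Graph n} → IsCograph G → Cotree G ⊤
cograph-cotree {G = G} (t , π , iso)
  with X , T , im ← construction-cotree t G (π ⟨$⟩ˡ_)
         (λ {i} {j} eq → trans (sym (inverseʳ π)) (trans (cong (π ⟨$⟩ʳ_) eq) (inverseʳ π)))
         (λ i j → mk⇔ (λ a → from (iso _ _) (subst₂ (Adj ⟦ t ⟧) (sym (inverseʳ π)) (sym (inverseʳ π)) a))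
                      (λ b → subst₂ (Adj ⟦ t ⟧) (inverseʳ π) (inverseʳ π) (to (iso _ _) b)))
  = subst (Cotree G) (⊆-antisym ⊆⊤ λ {v} _ → subst (_∈ X) (inverseˡ π) (value im (π ⟨$⟩ʳ v))) T

-- Greedy sets and their restrictions

least : ∀ {n} {P : Fin n → Set} → Decidable P → ∃ P → ∃[ b ] P b × (∀ {x} → P x → toℕ b ≤ toℕ x)
least {n} {P} P? (v , Pv) with b , ¬¬Pb , min ← Fin.¬∀⟶∃¬-smallest n (¬_ ∘ P) (¬? ∘ P?) (λ none → none v Pv) =
  b , decidable-stable (P? b) ¬¬Pb
    , λ {x} Px → ℕ.≮⇒≥ λ x<b →
        min (Fin.fromℕ< x<b)
          (subst P (Fin.toℕ-injective (sym (trans (Fin.toℕ-inject (Fin.fromℕ< x<b)) (Fin.toℕ-fromℕ< x<b)))) Px)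

-- Precedence in the index order with v moved to the front.
_≺[_]_ : ∀ {n} → Fin n → Fin n → Fin n → Set
y ≺[ v ] x = y Fin.< x ⊎ y ≡ v

-- When everything precedes everything, a vertex may be left out because of any neighbour in the
-- set, so `Greedy` becomes maximal independence in `G[X]`.
Always : ∀ {n} → Fin n → Fin n → Set
Always _ _ = Unit.⊤

module _ {n} (G : Graph n) where

  -- A maximal independent set of G[X] obtained greedily: a vertex of X is
  -- left out only because of a neighbour in C that precedes it.
  record Greedy (_≺_ : Fin n → Fin n → Set) (X C : Subset n) : Set where
    field
      subset      : C ⊆ X
      independent : Independent G C
      saturated   : ∀ {x} → x ∈ X → (∀ {y} → y ∈ C → y ≺ x → ¬ Adj G y x) → x ∈ C

  open Greedy

  GreedyFrom : Fin n → Subset n → Set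
  GreedyFrom v C = v ∈ C × Greedy _≺[ v ]_ ⊤ C

  -- More precedence gives more admissible reasons to leave a vertex out. Only adjacent pairs
  -- matter, since only neighbours can be such reasons.
  weaken : ∀ {R S X C} → (∀ {x y} → x ∈ X → y ∈ C → Adj G y x → R y x → S y x) →
    Greedy R X C → Greedy S X C
  weaken R⇒S g = record
    { subset      = subset g
    ; independent = independent g
    ; saturated   = λ x∈X free → saturated g x∈X λ y∈C yRx yx → free y∈C (R⇒S x∈X y∈C yx yRx) yx
    }

  private
    agree : ∀ {X C D} → Greedy Fin._<_ X C → Greedy Fin._<_ X D → ∀ {x} → Acc _<_ (toℕ x) → x ∈ C → x ∈ D
    agree g h (acc rec) x∈C = saturated h (subset g x∈C)
      λ y∈D y<x → independent g (agree h g (rec y<x) y∈D) x∈C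

  -- By strong induction on the index: a neighbour of `x ∈ C` that keeps `x` out of `D` is smaller
  -- than `x`, hence belongs to `C` too, against independence.
  greedy-unique : ∀ {X C D} → Greedy Fin._<_ X C → Greedy Fin._<_ X D → C ≡ D
  greedy-unique g h = ⊆-antisym (agree g h (<-wellFounded _)) (agree h g (<-wellFounded _))

  -- A neighbour in `C` that blocks a vertex of `X` cannot lie in `Y`, so it survives in `C ∩ X`.
  restrict-union : ∀ {R X Y Z C} → X ⊆ Z → (∀ {z} → z ∈ Z → z ∈ X ⊎ z ∈ Y) →
    (∀ {x y} → x ∈ X → y ∈ Y → ¬ Adj G x y) → Greedy R Z C → Greedy R X (C ∩ X)
  restrict-union {X = X} {C = C} X⊆Z cover separate g = record
    { subset      = p∩q⊆q C X
    ; independent = λ x∈ y∈ → independent g (p∩q⊆p C X x∈) (p∩q⊆p C X y∈)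
    ; saturated   = λ x∈X free → x∈p∩q⁺ (saturated g (X⊆Z x∈X) (λ y∈C yRx yx →
        [ (λ y∈X → free (x∈p∩q⁺ (y∈C , y∈X)) yRx yx) , (λ y∈Y → separate x∈X y∈Y (symm G yx)) ]′
          (cover (subset g y∈C))) , x∈X)
    }

  -- The vertex `v` of `C` in `X` is adjacent to all of `Y`, so independence keeps `C` out of `Y`
  -- and no intersection has to be taken.
  restrict-join : ∀ {R X Y Z C v} → X ⊆ Z → (∀ {z} → z ∈ Z → z ∈ X ⊎ z ∈ Y) →
    (∀ {x y} → x ∈ X → y ∈ Y → Adj G x y) → v ∈ C → v ∈ X → Greedy R Z C → Greedy R X C
  restrict-join X⊆Z cover complete v∈C v∈X g = record
    { subset      = λ y∈C → [ id , (λ y∈Y → contradiction (complete v∈X y∈Y) (independent g v∈C y∈C)) ]′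
                              (cover (subset g y∈C))
    ; independent = independent g
    ; saturated   = saturated g ∘ X⊆Z
    }

  greedy-maximal : ∀ {R C} → Greedy R ⊤ C → MaximalIndependent G C
  greedy-maximal g = independent g , λ J indep (C⊆J , x , x∈J , x∉C) →
    x∉C (saturated g ∈⊤ λ y∈C _ → indep (C⊆J y∈C) x∈J)

  independent-insert : ∀ {I x} → Independent G I → (∀ {y} → y ∈ I → ¬ Adj G y x) →
    Independent G (I ∪ ⁅ x ⁆)
  independent-insert {I} {x} indep free u∈ v∈ uv with x∈p∪q⁻ I ⁅ x ⁆ u∈ | x∈p∪q⁻ I ⁅ x ⁆ v∈
  ... | inj₁ u∈I | inj₁ v∈I = indep u∈I v∈I uv
  ... | inj₁ u∈I | inj₂ v∈x rewrite x∈⁅y⁆⇒x≡y x v∈x = free u∈I uv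
  ... | inj₂ u∈x | inj₁ v∈I rewrite x∈⁅y⁆⇒x≡y x u∈x = free v∈I (symm G uv)
  ... | inj₂ u∈x | inj₂ v∈x rewrite x∈⁅y⁆⇒x≡y x u∈x | x∈⁅y⁆⇒x≡y x v∈x = irrefl G uv

  maximal-greedy : ∀ {I} → MaximalIndependent G I → Greedy Always ⊤ I
  maximal-greedy {I} (indep , max) = record
    { subset      = ⊆⊤
    ; independent = indep
    ; saturated   = λ {x} _ free → decidable-stable (x ∈? I) λ x∉I →
        max (I ∪ ⁅ x ⁆) (independent-insert indep (λ y∈I → free y∈I tt))
          (p⊆p∪q ⁅ x ⁆ , x , x∈p∪q⁺ (inj₂ (x∈⁅x⁆ x)) , x∉I)
    }

  cotree-nonempty : ∀ {X} → Cotree G X → ∃[ v ] v ∈ X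
  cotree-nonempty (leaf v)        = v , x∈⁅x⁆ v
  cotree-nonempty (union s _ _ _) with v , v∈X ← cotree-nonempty s = v , x∈p∪q⁺ (inj₁ v∈X)
  cotree-nonempty (join s _ _)    with v , v∈X ← cotree-nonempty s = v , x∈p∪q⁺ (inj₁ v∈X)

  -- Precedence of `b` over a neighbour `x` in `X` is already index order: `b` is at most `x` by
  -- minimality and differs from it by irreflexivity.
  least-first : ∀ {b X C} → (∀ {x} → x ∈ X → toℕ b ≤ toℕ x) → Greedy _≺[ b ]_ X C → Greedy Fin._<_ X C
  least-first b≤ = weaken λ { _ _ _ (inj₁ y<x) → y<x
                            ; x∈X _ bx (inj₂ refl) → ℕ.≤∧≢⇒< (b≤ x∈X)
                                (λ b≡x → irrefl G (subst (Adj G _) (sym (Fin.toℕ-injective b≡x)) bx)) }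

  -- The greedy family determines all weights

  module _ (w : Fin n → ℝ) where

    -- The induction hypothesis on `w`: at the root it is the printed system, and it passes to both
    -- children of every node, at a join with a new reference set.
    GreedyFamily : Subset n → Subset n → Set
    GreedyFamily X C₀ = ∀ {v} → v ∈ X → ∃[ C ] v ∈ C × Greedy _≺[ v ]_ X C × weight w C ≈ weight w C₀

    restrict-family-union : ∀ {X Y Z C₀} → X ⊆ Z → Y ⊆ Z → (∀ {z} → z ∈ Z → z ∈ X ⊎ z ∈ Y) →
      (∀ {v} → v ∈ X → v ∉ Y) → (∀ {x y} → x ∈ X → y ∈ Y → ¬ Adj G x y) →
      Greedy Fin._<_ Z C₀ → GreedyFamily Z C₀ → GreedyFamily X (C₀ ∩ X)
    restrict-family-union {X} {Y} {Z} {C₀} X⊆Z Y⊆Z cover disjoint separate g₀ family {v} v∈X =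
        C ∩ X , x∈p∩q⁺ (v∈C , v∈X) , restrict-union X⊆Z cover separate g
      , ≈-by-difference {weight w C} {weight w C₀} {weight w (C ∩ X)} {weight w (C₀ ∩ X)} same C≈C₀
      where
      member = family (X⊆Z v∈X)
      C = proj₁ member
      v∈C = proj₁ (proj₂ member)
      g = proj₁ (proj₂ (proj₂ member))
      C≈C₀ = proj₂ (proj₂ (proj₂ member))
      onY : ∀ {R D} → Greedy R Z D → Greedy R Y (D ∩ Y)
      onY = restrict-union Y⊆Z (Sum.swap ∘ cover) (λ y∈Y x∈X → separate x∈X y∈Y ∘ symm G)
      C∩Y≡C₀∩Y : C ∩ Y ≡ C₀ ∩ Y
      C∩Y≡C₀∩Y = greedy-unique
        -- The exceptional precedence of `v` never applies within `Y`, which does not contain `v`.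
        (weaken (λ { _ _ _ (inj₁ y<x) → y<x
                   ; _ v∈ _ (inj₂ refl) → contradiction (p∩q⊆q C Y v∈) (disjoint v∈X) }) (onY g))
        (onY g₀)
      same : ∀ i → seq (weight w C) i ℚ.- seq (weight w C₀) i ≡
                   seq (weight w (C ∩ X)) i ℚ.- seq (weight w (C₀ ∩ X)) i
      same i = trans (cong₂ ℚ._-_ (weight-split w (cover ∘ subset g) disjoint i)
                                  (weight-split w (cover ∘ subset g₀) disjoint i))
        (trans (cong (λ D → (seq (weight w (C ∩ X)) i ℚ.+ seq (weight w D) i)
                            ℚ.- (seq (weight w (C₀ ∩ X)) i ℚ.+ seq (weight w (C₀ ∩ Y)) i)) C∩Y≡C₀∩Y)
          (cancel (seq (weight w (C ∩ X)) i) (seq (weight w (C₀ ∩ X)) i) (seq (weight w (C₀ ∩ Y)) i)))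
        where
        open +-*-Solver
        cancel : ∀ a b c → (a ℚ.+ c) ℚ.- (b ℚ.+ c) ≡ a ℚ.- b
        cancel = solve 3 (λ a b c → (a :+ c) :- (b :+ c) := a :- b) refl

    -- Inside one side of a join the least vertex of that side provides the
    -- reference set, whichever side C₀ lies in.
    restrict-family-join : ∀ {X Y Z C₀} → X ⊆ Z → (∀ {z} → z ∈ Z → z ∈ X ⊎ z ∈ Y) →
      (∀ {x y} → x ∈ X → y ∈ Y → Adj G x y) → ∃[ v ] v ∈ X → GreedyFamily Z C₀ →
      ∃[ C₁ ] Greedy Fin._<_ X C₁ × GreedyFamily X C₁ × weight w C₁ ≈ weight w C₀
    restrict-family-join {X} {C₀ = C₀} X⊆Z cover complete nonempty family =
      let b , b∈X , b≤ = least (_∈? X) nonempty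
          C₁ , b∈C₁ , g₁ , C₁≈C₀ = family (X⊆Z b∈X)
      in C₁
      , least-first b≤ (restrict-join X⊆Z cover complete b∈C₁ b∈X g₁)
      , (λ {v} v∈X → let C , v∈C , g , C≈C₀ = family (X⊆Z v∈X) in
           C , v∈C , restrict-join X⊆Z cover complete v∈C v∈X g ,
           ≈-trans {weight w C} {weight w C₀} {weight w C₁} C≈C₀ (≈-sym {weight w C₁} {weight w C₀} C₁≈C₀))
      , C₁≈C₀

    -- Induction on the cotree. The set `I` is an arbitrary maximal independent set of `G[Z]`; a
    -- union splits it into traces that are again maximal, and a join puts it on one side.
    greedy-family-determines : ∀ {Z C₀ I} → Cotree G Z → Greedy Fin._<_ Z C₀ → GreedyFamily Z C₀ →
      Greedy Always Z I → weight w I ≈ weight w C₀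
    greedy-family-determines {C₀ = C₀} {I} (leaf v) g₀ _ h =
      ≈-reflexive {weight w I} {weight w C₀} (cong (weight w)
        (⊆-antisym (λ x∈I → only g₀ (subset h x∈I)) (λ x∈C₀ → only h (subset g₀ x∈C₀))))
      where
      only : ∀ {R C x} → Greedy R ⁅ v ⁆ C → x ∈ ⁅ v ⁆ → x ∈ C
      only {x = x} g x∈ = saturated g x∈ λ y∈C _ → subst₂ (λ a b → ¬ Adj G a b)
        (sym (x∈⁅y⁆⇒x≡y v (subset g y∈C))) (sym (x∈⁅y⁆⇒x≡y v x∈)) (irrefl G)
    greedy-family-determines {C₀ = C₀} {I} (union {X} {Y} s t disjoint separate) g₀ family h =
      -- Exchange the trace on X first, then the one on Y.
      ≈-trans {weight w I} {J} {weight w C₀}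
        (≈-by-difference {weight w (I ∩ X)} {weight w (C₀ ∩ X)} {weight w I} {J}
          (λ i → trans (shift (seq (weight w (I ∩ X)) i) (seq (weight w (C₀ ∩ X)) i) (seq (weight w (I ∩ Y)) i))
            (cong (ℚ._- seq J i) (sym (weight-split w (cover ∘ subset h) disjoint i))))
          (greedy-family-determines s (onX g₀)
            (restrict-family-union (p⊆p∪q Y) (q⊆p∪q X Y) cover disjoint separate g₀ family) (onX h)))
        (≈-by-difference {weight w (I ∩ Y)} {weight w (C₀ ∩ Y)} {J} {weight w C₀}
          (λ i → trans (shift′ (seq (weight w (I ∩ Y)) i) (seq (weight w (C₀ ∩ Y)) i) (seq (weight w (C₀ ∩ X)) i))
            (cong (λ a → seq J i ℚ.- a) (sym (weight-split w (cover ∘ subset g₀) disjoint i))))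
          (greedy-family-determines t (onY g₀)
            (restrict-family-union (q⊆p∪q X Y) (p⊆p∪q Y) (Sum.swap ∘ cover) (flip disjoint) separate′ g₀ family) (onY h)))
      where
      -- The weight of a hybrid with the trace of `C₀` on `X` and that of `I` on `Y`. As a mere sum,
      -- it spares building the hybrid set.
      J : ℝ
      J = weight w (C₀ ∩ X) + weight w (I ∩ Y)
      cover : ∀ {z} → z ∈ X ∪ Y → z ∈ X ⊎ z ∈ Y
      cover = x∈p∪q⁻ X Y
      separate′ : ∀ {y x} → y ∈ Y → x ∈ X → ¬ Adj G y x
      separate′ y∈Y x∈X = separate x∈X y∈Y ∘ symm G
      onX : ∀ {R D} → Greedy R (X ∪ Y) D → Greedy R X (D ∩ X)
      onX = restrict-union (p⊆p∪q Y) cover separate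
      onY : ∀ {R D} → Greedy R (X ∪ Y) D → Greedy R Y (D ∩ Y)
      onY = restrict-union (q⊆p∪q X Y) (Sum.swap ∘ cover) separate′
      open +-*-Solver
      shift : ∀ a b c → a ℚ.- b ≡ (a ℚ.+ c) ℚ.- (b ℚ.+ c)
      shift = solve 3 (λ a b c → a :- b := (a :+ c) :- (b :+ c)) refl
      shift′ : ∀ a b c → a ℚ.- b ≡ (c ℚ.+ a) ℚ.- (c ℚ.+ b)
      shift′ = solve 3 (λ a b c → a :- b := (c :+ a) :- (c :+ b)) refl
    greedy-family-determines {C₀ = C₀} {I} (join {X} {Y} s t complete) g₀ family h =
      [ (λ i∈X → side s (restrict-family-join {C₀ = C₀} (p⊆p∪q Y) cover complete (cotree-nonempty s) family)
                   (restrict-join (p⊆p∪q Y) cover complete i∈I i∈X h))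
      , (λ i∈Y → side t (restrict-family-join {C₀ = C₀} (q⊆p∪q X Y) (Sum.swap ∘ cover) complete′ (cotree-nonempty t) family)
                   (restrict-join (q⊆p∪q X Y) (Sum.swap ∘ cover) complete′ i∈I i∈Y h))
      ]′ (cover (subset h i∈I))
      where
      cover : ∀ {z} → z ∈ X ∪ Y → z ∈ X ⊎ z ∈ Y
      cover = x∈p∪q⁻ X Y
      complete′ : ∀ {y x} → y ∈ Y → x ∈ X → Adj G y x
      complete′ y∈Y x∈X = symm G (complete x∈X y∈Y)
      side : ∀ {S} → Cotree G S →
        ∃[ C₁ ] Greedy Fin._<_ S C₁ × GreedyFamily S C₁ × weight w C₁ ≈ weight w C₀ →
        Greedy Always S I → weight w I ≈ weight w C₀
      side r (C₁ , g₁ , family₁ , C₁≈C₀) k =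
        ≈-trans {weight w I} {weight w C₁} {weight w C₀} (greedy-family-determines r g₁ family₁ k) C₁≈C₀
      -- Any vertex of `I` tells the side that contains `I`. One exists, since the node has a vertex
      -- and nothing in an empty `I` could block it.
      nonempty : ∃[ i ] i ∈ I
      nonempty = decidable-stable (Fin.any? (_∈? I)) λ empty →
        empty (_ , saturated h (proj₂ (cotree-nonempty (join s t complete)))
          (λ y∈I _ _ → empty (_ , y∈I)))
      i∈I : proj₁ nonempty ∈ I
      i∈I = proj₂ nonempty

-- Degree sum and number of edges

unique-⊆⇒length-≤ : ∀ {A : Set} {xs ys : List A} → Unique xs →
  (∀ {x} → x ∈ˡ xs → x ∈ˡ ys) → length xs ≤ length ys
unique-⊆⇒length-≤ {xs = []}     _            _     = z≤n
unique-⊆⇒length-≤ {xs = x ∷ xs} (x∉xs ∷ uniq) xs⊆ys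
  with as , bs , refl ← ∈-∃++ (xs⊆ys (here refl)) =
    subst (suc (length xs) ≤_) (sym (List.length-++-sucʳ as x bs))
      (s≤s (unique-⊆⇒length-≤ uniq λ y∈xs → avoid (All.lookup x∉xs y∈xs) (∈-++⁻ as (xs⊆ys (there y∈xs)))))
  where
  avoid : ∀ {y} → x ≢ y → y ∈ˡ as ⊎ y ∈ˡ x ∷ bs → y ∈ˡ as ++ bs
  avoid x≢y (inj₁ y∈as)         = ∈-++⁺ˡ y∈as
  avoid x≢y (inj₂ (here refl))  = contradiction refl x≢y
  avoid x≢y (inj₂ (there y∈bs)) = ∈-++⁺ʳ as y∈bs

length-filter-⊎ : ∀ {A : Set} {P Q R : A → Set} (P? : Decidable P) (Q? : Decidable Q) (R? : Decidable R) →
  (∀ {x} → P x → Q x ⊎ R x) → ∀ xs → length (filter P? xs) ≤ length (filter Q? xs) +ℕ length (filter R? xs)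
length-filter-⊎ P? Q? R? P⇒Q⊎R []       = z≤n
length-filter-⊎ P? Q? R? P⇒Q⊎R (x ∷ xs) with rec ← length-filter-⊎ P? Q? R? P⇒Q⊎R xs | P? x | Q? x | R? x
... | no  _ | no  _ | no  _ = rec
... | no  _ | no  _ | yes _ = ℕ.≤-trans rec (ℕ.+-monoʳ-≤ (length (filter Q? xs)) (ℕ.n≤1+n _))
... | no  _ | yes _ | no  _ = ℕ.m≤n⇒m≤1+n rec
... | no  _ | yes _ | yes _ = ℕ.m≤n⇒m≤1+n (ℕ.≤-trans rec (ℕ.+-monoʳ-≤ (length (filter Q? xs)) (ℕ.n≤1+n _)))
... | yes _ | yes _ | no  _ = s≤s rec
... | yes _ | yes _ | yes _ = s≤s (ℕ.≤-trans rec (ℕ.+-monoʳ-≤ (length (filter Q? xs)) (ℕ.n≤1+n _)))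
... | yes _ | no  _ | yes _ = ℕ.≤-trans (s≤s rec) (ℕ.≤-reflexive (sym (ℕ.+-suc (length (filter Q? xs)) _)))
... | yes p | no ¬q | no ¬r = contradiction (P⇒Q⊎R p) [ ¬q , ¬r ]′

module _ {n} {G : Graph n} (L : AdjacencyLists G) where

  degree : Fin n → ℕ
  degree = length ∘ nbrs L

  degree≤n : ∀ v → degree v ≤ n
  degree≤n v = subst (degree v ≤_) (List.length-tabulate id)
    (unique-⊆⇒length-≤ (unique L v) (λ {u} _ → ∈-allFin u))

  degrees : List (Fin n) → ℕ
  degrees = ListAction.sum ∘ map degree

  private
    arc? : Decidable (λ e → Adj G (proj₁ e) (proj₂ e))
    arc? e = adj? G (proj₁ e) (proj₂ e)

    edge? : Decidable (λ e → proj₁ e Fin.< proj₂ e × Adj G (proj₁ e) (proj₂ e))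
    edge? e = (proj₁ e Fin.<? proj₂ e) ×-dec arc? e

    pairs : List (Fin n × Fin n)
    pairs = cartesianProduct (allFin n) (allFin n)

    pair∈pairs : ∀ e → e ∈ˡ pairs
    pair∈pairs (u , v) = ∈-cartesianProduct⁺ (∈-allFin u) (∈-allFin v)

    degrees≤arcs : ∀ us → degrees us ≤ length (filter arc? (cartesianProduct us (allFin n)))
    degrees≤arcs []       = z≤n
    degrees≤arcs (u ∷ us) = begin
      degree u +ℕ degrees us
        ≤⟨ ℕ.+-mono-≤ here-≤ (degrees≤arcs us) ⟩
      length (filter arc? row) +ℕ length (filter arc? rest)
        ≡⟨ List.length-++ (filter arc? row) ⟨
      length (filter arc? row ++ filter arc? rest)
        ≡⟨ cong length (List.filter-++ arc? row rest) ⟨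
      length (filter arc? (row ++ rest)) ∎
      where
      open ℕ.≤-Reasoning
      row  = map (u ,_) (allFin n)
      rest = cartesianProduct us (allFin n)
      here-≤ : degree u ≤ length (filter arc? row)
      here-≤ = subst (_≤ length (filter arc? row)) (List.length-map (u ,_) (nbrs L u))
        (unique-⊆⇒length-≤ (Unique.map⁺ (cong proj₂) (unique L u)) λ e∈ → neighbour (∈-map⁻ (u ,_) e∈))
        where
        neighbour : ∀ {e} → ∃[ v ] v ∈ˡ nbrs L u × e ≡ (u , v) → e ∈ˡ filter arc? row
        neighbour (v , v∈ , refl) = ∈-filter⁺ arc? (∈-map⁺ (u ,_) (∈-allFin v)) (to (correct L u v) v∈)

  -- Every arc goes up or down in the index order. The upward arcs are the pairs counted by `∣E∣ G`,
  -- and `swap` maps the downward arcs injectively to them.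
  handshake : degrees (allFin n) ≤ ∣E∣ G +ℕ ∣E∣ G
  handshake = begin
    degrees (allFin n)
      ≤⟨ degrees≤arcs (allFin n) ⟩
    length (filter arc? pairs)
      ≤⟨ length-filter-⊎ arc? edge? (edge? ∘ swap) orient pairs ⟩
    ∣E∣ G +ℕ length (filter (edge? ∘ swap) pairs)
      ≡⟨ cong (∣E∣ G +ℕ_) (List.length-map swap (filter (edge? ∘ swap) pairs)) ⟨
    ∣E∣ G +ℕ length (map swap (filter (edge? ∘ swap) pairs))
      ≤⟨ ℕ.+-monoʳ-≤ (∣E∣ G) (unique-⊆⇒length-≤
           (Unique.map⁺ (cong swap) (Unique.filter⁺ (edge? ∘ swap)
             (Unique.cartesianProduct⁺ (Unique.allFin⁺ n) (Unique.allFin⁺ n))))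
           (reversed ∘ ∈-map⁻ swap)) ⟩
    ∣E∣ G +ℕ ∣E∣ G ∎
    where
    open ℕ.≤-Reasoning
    orient : ∀ {e} → Adj G (proj₁ e) (proj₂ e) →
      (proj₁ e Fin.< proj₂ e × Adj G (proj₁ e) (proj₂ e)) ⊎ (proj₂ e Fin.< proj₁ e × Adj G (proj₂ e) (proj₁ e))
    orient {u , v} uv with Fin.<-cmp u v
    ... | tri< u<v _ _ = inj₁ (u<v , uv)
    ... | tri≈ _ refl _ = contradiction uv (irrefl G)
    ... | tri> _ _ v<u = inj₂ (v<u , symm G uv)
    reversed : ∀ {e} → ∃[ e′ ] e′ ∈ˡ filter (edge? ∘ swap) pairs × e ≡ swap e′ → e ∈ˡ filter edge? pairs
    reversed (e′ , e′∈ , refl) = ∈-filter⁺ edge? (pair∈pairs (swap e′))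
      (proj₂ (∈-filter⁻ (edge? ∘ swap) {xs = pairs} e′∈))

-- The program and its data in memory

-- Array 1 holds I(v), as bits, in the n cells from v * n on, which are still
-- zero when round v starts.  Registers: 0 holds n, 1 holds 1, 2 the number of
-- remaining rounds, 3 the source v, 4 holds v * n, 5 the reading position in the
-- input, 6 the current vertex u, 7 the number of vertices left in the scan, 8 the
-- number of neighbours of u left, 9 the number of chosen neighbours of u.  While
-- a row is printed, 8 and 9 hold the sign and the absolute value of an entry.
accumulate select greedy report advance round wellCoveringProgram : Program
accumulate =
  load 10 0 5 ⨾ op add 10 4 10 ⨾ load 10 1 10 ⨾ op add 9 9 10 ⨾ op add 5 5 1 ⨾ op sub 8 8 1
select =
  load 8 0 5 ⨾ op add 5 5 1 ⨾ const 9 0 ⨾ while 8 accumulate ⨾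
  op add 10 4 6 ⨾ ifNZ 9 skip (store 1 10 1) ⨾ op add 6 6 1 ⨾ op sub 7 0 6
greedy =
  op add 10 4 3 ⨾ store 1 10 1 ⨾ const 5 1 ⨾ const 6 0 ⨾ op sub 7 0 6 ⨾ while 7 select
report =
  op add 10 4 6 ⨾ load 10 1 10 ⨾ load 11 1 6 ⨾ op sub 8 11 10 ⨾ op sub 9 10 11 ⨾
  op add 9 8 9 ⨾ print 8 ⨾ print 9 ⨾ op add 6 6 1 ⨾ op sub 7 0 6
advance = op add 4 4 0 ⨾ op add 3 3 1 ⨾ op sub 2 0 3
round = greedy ⨾ const 6 0 ⨾ op sub 7 0 6 ⨾ while 7 report ⨾ advance
wellCoveringProgram = load 0 0 0 ⨾ const 1 1 ⨾ greedy ⨾ advance ⨾ while 2 round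

bit : Bool → ℕ
bit b = if b then 1 else 0

bit≤1 : ∀ b → bit b ≤ 1
bit≤1 true  = s≤s z≤n
bit≤1 false = z≤n

bit-∈ : ∀ {n} {C : Subset n} {x} → x ∈ C → bit (lookup C x) ≡ 1
bit-∈ = cong bit ∘ Vec.[]=⇒lookup

bit-∉ : ∀ {n} {C : Subset n} {x} → x ∉ C → bit (lookup C x) ≡ 0
bit-∉ {C = C} {x} x∉C with lookup C x in eq
... | true  = contradiction (Vec.lookup⇒[]= x C eq) x∉C
... | false = refl

-- Truncated subtraction does the case analysis: `bit c ∸ bit b` is 1 exactly for the coefficient
-- -1, and adding the opposite difference yields the absolute value. `report` computes these two
-- numbers.
encode-coefficient : ∀ b c →
  encodeℤ (coefficient b c) ≡ bit c ∸ bit b ∷ (bit c ∸ bit b) +ℕ (bit b ∸ bit c) ∷ []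
encode-coefficient true  true  = refl
encode-coefficient true  false = refl
encode-coefficient false true  = refl
encode-coefficient false false = refl

update-same : ∀ (f : ℕ → ℕ) k a → (f [ k ↦ a ]) k ≡ a
update-same f k a = cong (if_then a else f k) (dec-true (k ℕ.≟ k) refl)

update-other : ∀ (f : ℕ → ℕ) {k a j} → j ≢ k → (f [ k ↦ a ]) j ≡ f j
update-other f {k} {a} {j} j≢k = cong (if_then a else f j) (dec-false (j ℕ.≟ k) j≢k)

Row : ∀ {n} → ℕ → Subset n → (ℕ → ℕ) → Set
Row b C μ = ∀ x → μ (b +ℕ toℕ x) ≡ bit (lookup C x)

row-insert : ∀ {n b μ} {C : Subset n} u → Row b C μ → Row b (C ∪ ⁅ u ⁆) (μ [ b +ℕ toℕ u ↦ 1 ])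
row-insert {b = b} {μ} {C} u row x with x Fin.≟ u | x ∈? C
... | yes refl | _ = trans (update-same μ _ 1) (sym (bit-∈ (x∈p∪q⁺ {p = C} (inj₂ (x∈⁅x⁆ x)))))
... | no x≢u | yes x∈C = trans (update-other μ (x≢u ∘ Fin.toℕ-injective ∘ ℕ.+-cancelˡ-≡ b _ _))
  (trans (row x) (trans (bit-∈ x∈C) (sym (bit-∈ (x∈p∪q⁺ (inj₁ x∈C))))))
... | no x≢u | no x∉C = trans (update-other μ (x≢u ∘ Fin.toℕ-injective ∘ ℕ.+-cancelˡ-≡ b _ _))
  (trans (row x) (trans (bit-∉ x∉C) (sym (bit-∉ ([ x∉C , x≢u ∘ x∈⁅y⁆⇒x≡y u ]′ ∘ x∈p∪q⁻ C ⁅ u ⁆)))))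

count : ∀ {n} → Subset n → List (Fin n) → ℕ
count C = ListAction.sum ∘ map (bit ∘ lookup C)

count≡0 : ∀ {n} {C : Subset n} {xs} → count C xs ≡ 0 → ∀ {x} → x ∈ˡ xs → x ∉ C
count≡0 {C = C} {y ∷ ys} eq (here refl) y∈C with () ← trans (sym eq) (cong (_+ℕ count C ys) (bit-∈ y∈C))
count≡0 {C = C} {y ∷ ys} eq (there x∈) = count≡0 (ℕ.m+n≡0⇒n≡0 (bit (lookup C y)) eq) x∈

count≢0 : ∀ {n} {C : Subset n} xs → count C xs ≢ 0 → ∃[ x ] x ∈ˡ xs × x ∈ C
count≢0         []       ≢0 = contradiction refl ≢0
count≢0 {C = C} (y ∷ ys) ≢0 with y ∈? C
... | yes y∈C = y , here refl , y∈C
... | no  y∉C with x , x∈ , x∈C ← count≢0 {C = C} ys (≢0 ∘ cong₂ _+ℕ_ (bit-∉ y∉C)) = x , there x∈ , x∈C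

-- The scan invariant

module _ {n} (G : Graph n) where

  -- The invariant of a scan that has treated the vertices below a.
  record Prefix (v : Fin n) (a : ℕ) (C : Subset n) : Set where
    field
      source      : v ∈ C
      processed   : ∀ {x} → x ∈ C → toℕ x < a ⊎ x ≡ v
      independent : Independent G C
      saturated   : ∀ {x} → toℕ x < a → (∀ {y} → y ∈ C → y ≺[ v ] x → ¬ Adj G y x) → x ∈ C

  open Prefix

  -- The singleton appears as `⊥ ∪ ⁅ v ⁆` to match `row-insert` applied to an empty row, which is
  -- what the first store of a scan does.
  prefix-start : ∀ v → Prefix v 0 (⊥ ∪ ⁅ v ⁆)
  prefix-start v = record
    { source      = x∈p∪q⁺ (inj₂ (x∈⁅x⁆ v))
    ; processed   = inj₂ ∘ only
    ; independent = λ x∈ y∈ xy → irrefl G (subst₂ (Adj G) (only x∈) (only y∈) xy)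
    ; saturated   = λ ()
    }
    where
    only : ∀ {x} → x ∈ ⊥ ∪ ⁅ v ⁆ → x ≡ v
    only x∈ = [ (λ x∈⊥ → contradiction x∈⊥ ∉⊥) , x∈⁅y⁆⇒x≡y v ]′ (x∈p∪q⁻ ⊥ ⁅ v ⁆ x∈)

  prefix-insert : ∀ {v u C} → (∀ {y} → y ∈ C → ¬ Adj G y u) →
    Prefix v (toℕ u) C → Prefix v (suc (toℕ u)) (C ∪ ⁅ u ⁆)
  prefix-insert {v} {u} {C} free P = record
    { source      = x∈p∪q⁺ (inj₁ (source P))
    ; processed   = [ Sum.map₁ ℕ.m<n⇒m<1+n ∘ processed P , (λ x∈ → inj₁ (s≤s (ℕ.≤-reflexive (cong toℕ (x∈⁅y⁆⇒x≡y u x∈))))) ]′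
                    ∘ x∈p∪q⁻ C ⁅ u ⁆
    ; independent = independent-insert G (independent P) free
    ; saturated   = λ {x} x<1+u free′ → x∈p∪q⁺ ([ (λ x<u → inj₁ (saturated P x<u (free′ ∘ x∈p∪q⁺ ∘ inj₁)))
                    , (λ x≡u → inj₂ (subst (_∈ ⁅ u ⁆) (sym (Fin.toℕ-injective x≡u)) (x∈⁅x⁆ u))) ]′
                    (ℕ.m<1+n⇒m<n∨m≡n x<1+u))
    }

  -- The program counts all chosen neighbours of `u`, not only preceding ones. By `processed` this
  -- is the same: a chosen `y` is below `u` or equals `v`.
  prefix-skip : ∀ {v u C y} → y ∈ C → Adj G y u → Prefix v (toℕ u) C → Prefix v (suc (toℕ u)) C
  prefix-skip {v} {u} {C} y∈C yu P = record
    { source      = source P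
    ; processed   = Sum.map₁ ℕ.m<n⇒m<1+n ∘ processed P
    ; independent = independent P
    ; saturated   = λ x<1+u free → [ (λ x<u → saturated P x<u free)
                    , (λ x≡u → contradiction (subst (Adj G _) (sym (Fin.toℕ-injective x≡u)) yu)
                        (free y∈C (Sum.map₁ (λ y<u → subst (_ <_) (sym x≡u) y<u) (processed P y∈C)))) ]′
                    (ℕ.m<1+n⇒m<n∨m≡n x<1+u)
    }

  prefix-greedy : ∀ {v C} → Prefix v n C → Greedy G _≺[ v ]_ ⊤ C
  prefix-greedy P = record
    { subset      = ⊆⊤
    ; independent = independent P
    ; saturated   = λ {x} _ → saturated P (Fin.toℕ<n x)
    }

-- Step counts

-- What a scan must not disturb. Writes to the scratch registers and to array 1 preserve `frame` by
-- computation, so one equation carries all six components through a run.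
record Frame : Set where
  constructor mkFrame
  field
    size one source base : ℕ
    input                : ℕ → ℕ
    output               : List ℕ

open Frame

frame : State → Frame
frame σ = mkFrame (reg σ 0) (reg σ 1) (reg σ 3) (reg σ 4) (arr σ 0) (out σ)

module _ {n} {G : Graph n} (L : AdjacencyLists G) where

  block : Fin n → List ℕ
  block u = degree L u ∷ map toℕ (nbrs L u)

  layout : ℕ → ℕ → List ℕ → Frame
  layout v b o = mkFrame n 1 v b (contents (encodeGraph L)) o

  -- The time functions are the step counts that the executions below yield.
  selectTime : List (Fin n) → ℕ
  selectTime []       = 1
  selectTime (u ∷ us) = suc (3 +ℕ (degree L u *ℕ 7 +ℕ 1 +ℕ 5) +ℕ selectTime us)

  greedyTime : ℕ
  greedyTime = 5 +ℕ selectTime (allFin n)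

  roundTime : ℕ
  roundTime = greedyTime +ℕ (2 +ℕ (n *ℕ 11 +ℕ 1 +ℕ 3))

  roundsTime : ℕ → ℕ
  roundsTime zero    = 1
  roundsTime (suc k) = suc (roundTime +ℕ roundsTime k)

  selectTime≡ : ∀ us → selectTime us ≡ 1 +ℕ (10 *ℕ length us +ℕ 7 *ℕ degrees L us)
  selectTime≡ []       = refl
  selectTime≡ (u ∷ us) = trans (cong (λ t → suc (3 +ℕ (degree L u *ℕ 7 +ℕ 1 +ℕ 5) +ℕ t)) (selectTime≡ us))
    (rearrange (degree L u) (length us) (degrees L us))
    where
    open ℕ-Solver
    rearrange : ∀ d l e → suc (3 +ℕ (d *ℕ 7 +ℕ 1 +ℕ 5) +ℕ (1 +ℕ (10 *ℕ l +ℕ 7 *ℕ e))) ≡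
      1 +ℕ (10 *ℕ suc l +ℕ 7 *ℕ (d +ℕ e))
    rearrange = solve 3 (λ d l e → con 4 :+ (d :* con 7 :+ con 1 :+ con 5) :+ (con 1 :+ (con 10 :* l :+ con 7 :* e))
      := con 1 :+ (con 10 :* (con 1 :+ l) :+ con 7 :* (d :+ e))) refl

  roundsTime≡ : ∀ k → roundsTime k ≡ 1 +ℕ k *ℕ suc roundTime
  roundsTime≡ zero    = refl
  roundsTime≡ (suc k) = cong suc (trans (cong (roundTime +ℕ_) (roundsTime≡ k)) (ℕ.+-suc roundTime (k *ℕ suc roundTime)))

-- With n = k + 1 and degree sum D, a round and its loop test take 13 + 21n + 7D steps, at most 34n
-- + 7D as n ≥ 1; this is the origin of 34. The start of the program fits into the budget of one
-- more round, and D is at most 2m. The added polynomials in `k` and `m` are the exact slack, so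
-- that the rest is a ring identity.
time-bound : ∀ {k} {G : Graph (suc k)} (L : AdjacencyLists G) →
  2 +ℕ (greedyTime L +ℕ (3 +ℕ roundsTime L k)) ≤ 34 *ℕ (suc k *ℕ (suc k +ℕ ∣E∣ G))
time-bound {k} {G} L = begin
  2 +ℕ (5 +ℕ t +ℕ (3 +ℕ roundsTime L k))
    ≡⟨ cong (λ r → 2 +ℕ (5 +ℕ t +ℕ (3 +ℕ r))) (roundsTime≡ L k) ⟩
  2 +ℕ (5 +ℕ t +ℕ (3 +ℕ (1 +ℕ k *ℕ suc (5 +ℕ t +ℕ (2 +ℕ (suc k *ℕ 11 +ℕ 1 +ℕ 3))))))
    ≡⟨ cong (λ t → 2 +ℕ (5 +ℕ t +ℕ (3 +ℕ (1 +ℕ k *ℕ suc (5 +ℕ t +ℕ (2 +ℕ (suc k *ℕ 11 +ℕ 1 +ℕ 3)))))))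
         (trans (selectTime≡ L (allFin (suc k)))
           (cong (λ l → 1 +ℕ (10 *ℕ l +ℕ 7 *ℕ D)) (List.length-tabulate {n = suc k} id))) ⟩
  2 +ℕ (5 +ℕ t′ +ℕ (3 +ℕ (1 +ℕ k *ℕ suc (5 +ℕ t′ +ℕ (2 +ℕ (suc k *ℕ 11 +ℕ 1 +ℕ 3))))))
    ≤⟨ ℕ.m≤m+n _ (12 +ℕ 24 *ℕ k +ℕ 13 *ℕ (k *ℕ k)) ⟩
  2 +ℕ (5 +ℕ t′ +ℕ (3 +ℕ (1 +ℕ k *ℕ suc (5 +ℕ t′ +ℕ (2 +ℕ (suc k *ℕ 11 +ℕ 1 +ℕ 3)))))) +ℕ (12 +ℕ 24 *ℕ k +ℕ 13 *ℕ (k *ℕ k))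
    ≡⟨ collect k D ⟩
  suc k *ℕ (34 *ℕ suc k +ℕ 7 *ℕ D)
    ≤⟨ ℕ.*-monoʳ-≤ (suc k) (ℕ.+-monoʳ-≤ (34 *ℕ suc k) (ℕ.*-monoʳ-≤ 7 (handshake L))) ⟩
  suc k *ℕ (34 *ℕ suc k +ℕ 7 *ℕ (m +ℕ m))
    ≤⟨ ℕ.m≤m+n _ (suc k *ℕ (20 *ℕ m)) ⟩
  suc k *ℕ (34 *ℕ suc k +ℕ 7 *ℕ (m +ℕ m)) +ℕ suc k *ℕ (20 *ℕ m)
    ≡⟨ factor (suc k) m ⟩
  34 *ℕ (suc k *ℕ (suc k +ℕ m)) ∎
  where
  open ℕ.≤-Reasoning
  open ℕ-Solver
  m = ∣E∣ G
  D = degrees L (allFin (suc k))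
  t = selectTime L (allFin (suc k))
  t′ = 1 +ℕ (10 *ℕ suc k +ℕ 7 *ℕ D)
  collect : ∀ k D → let t = 1 +ℕ (10 *ℕ suc k +ℕ 7 *ℕ D) in
    2 +ℕ (5 +ℕ t +ℕ (3 +ℕ (1 +ℕ k *ℕ suc (5 +ℕ t +ℕ (2 +ℕ (suc k *ℕ 11 +ℕ 1 +ℕ 3)))))) +ℕ
      (12 +ℕ 24 *ℕ k +ℕ 13 *ℕ (k *ℕ k))
    ≡ suc k *ℕ (34 *ℕ suc k +ℕ 7 *ℕ D)
  collect = solve 2 (λ k D → let t = con 1 :+ (con 10 :* (con 1 :+ k) :+ con 7 :* D) in
    con 2 :+ (con 5 :+ t :+ (con 3 :+ (con 1 :+ k :*
      (con 1 :+ (con 5 :+ t :+ (con 2 :+ ((con 1 :+ k) :* con 11 :+ con 1 :+ con 3)))))))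
      :+ (con 12 :+ con 24 :* k :+ con 13 :* (k :* k)) := (con 1 :+ k) :* (con 34 :* (con 1 :+ k) :+ con 7 :* D)) refl
  factor : ∀ n m → n *ℕ (34 *ℕ n +ℕ 7 *ℕ (m +ℕ m)) +ℕ n *ℕ (20 *ℕ m) ≡ 34 *ℕ (n *ℕ (n +ℕ m))
  factor = solve 2 (λ n m → n :* (con 34 :* n :+ con 7 :* (m :+ m)) :+ n :* (con 20 :* m)
    := con 34 :* (n :* (n :+ m))) refl

-- Executions within the word range

module _ {n} {G : Graph n} (L : AdjacencyLists G) {W : ℕ} (wide : suc (n +ℕ n *ℕ n) < W) where

  private
    -- One cell for n, and for each vertex its degree and at most n neighbours: a bound on the input
    -- length, hence on reading positions, which also exceeds all indices into the n² cells of array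
    -- 1.
    capacity : ℕ
    capacity = suc (n +ℕ n *ℕ n)

    ≤capacity⇒<W : ∀ {x} → x ≤ capacity → x < W
    ≤capacity⇒<W x≤capacity = ℕ.≤-<-trans x≤capacity wide

    ≤n⇒<W : ∀ {x} → x ≤ n → x < W
    ≤n⇒<W x≤n = ≤capacity⇒<W (ℕ.m≤n⇒m≤1+n (ℕ.≤-trans x≤n (ℕ.m≤m+n n (n *ℕ n))))

    ≤n²⇒<W : ∀ {x} → x ≤ n *ℕ n → x < W
    ≤n²⇒<W x≤n² = ≤capacity⇒<W (ℕ.m≤n⇒m≤1+n (ℕ.≤-trans x≤n² (ℕ.m≤n+m (n *ℕ n) n)))

    0<W : 0 < W
    0<W = ≤n⇒<W z≤n

    1<W : 1 < W
    1<W = ≤capacity⇒<W (s≤s z≤n)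

  -- Here `xs` is the whole unread input: `at` covers every `j`, with zeros past the end, so
  -- consuming a number is a shift of the index.
  record Reads (μ : ℕ → ℕ) (p : ℕ) (xs : List ℕ) : Set where
    field
      at   : ∀ j → μ (p +ℕ j) ≡ contents xs j
      fits : p +ℕ length xs ≤ capacity

  open Reads

  reads-head : ∀ {μ p x xs} → Reads μ p (x ∷ xs) → μ p ≡ x
  reads-head {μ} {p} r = trans (cong μ (sym (ℕ.+-identityʳ p))) (at r 0)

  reads-next : ∀ {μ p x xs} → Reads μ p (x ∷ xs) → Reads μ (p +ℕ 1) xs
  reads-next {μ} {p} {x} {xs} r = record
    { at   = λ j → trans (cong μ (ℕ.+-assoc p 1 j)) (at r (suc j))
    ; fits = subst (_≤ capacity) (sym (ℕ.+-assoc p 1 (length xs))) (fits r)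
    }

  reads-< : ∀ {μ p x xs} → Reads μ p (x ∷ xs) → p +ℕ 1 < W
  reads-< {p = p} {xs = xs} r =
    ≤capacity⇒<W (ℕ.≤-trans (ℕ.+-monoʳ-≤ p (s≤s (z≤n {length xs}))) (fits r))

  vertex-index : ∀ {b} → b +ℕ n ≤ n *ℕ n → (x : Fin n) → b +ℕ toℕ x < W
  vertex-index {b} b+n≤n² x = ≤n²⇒<W (ℕ.≤-trans (ℕ.+-monoʳ-≤ b (ℕ.<⇒≤ (Fin.toℕ<n x))) b+n≤n²)

  length-blocks : ∀ us → length (concatMap (block L) us) ≤ length us *ℕ suc n
  length-blocks []       = z≤n
  length-blocks (u ∷ us) = begin
    length (block L u ++ concatMap (block L) us)
      ≡⟨ List.length-++ (block L u) ⟩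
    suc (length (map toℕ (nbrs L u))) +ℕ length (concatMap (block L) us)
      ≤⟨ ℕ.+-mono-≤ (s≤s (ℕ.≤-trans (ℕ.≤-reflexive (List.length-map toℕ (nbrs L u))) (degree≤n L u))) (length-blocks us) ⟩
    suc n +ℕ length us *ℕ suc n ∎
    where open ℕ.≤-Reasoning

  reads-input : Reads (contents (encodeGraph L)) 1 (concatMap (block L) (allFin n))
  reads-input = record
    { at   = λ _ → refl
    ; fits = s≤s (ℕ.≤-trans (length-blocks (allFin n))
        (ℕ.≤-reflexive (trans (cong (_*ℕ suc n) (List.length-tabulate {n = n} id)) (ℕ.*-suc n n))))
    }

  module _ {b} (b+n≤n² : b +ℕ n ≤ n *ℕ n) where

    -- The bound on `reg σ 9 +ℕ length xs` keeps the counter in the word range: each neighbour adds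
    -- at most one and shortens the list by one.
    accumulate-exec : ∀ {v o C μ u rest} xs σ → frame σ ≡ layout L v b o → reg σ 6 ≡ u →
      arr σ 1 ≡ μ → Row b C μ → reg σ 8 ≡ length xs → reg σ 9 +ℕ length xs ≤ n →
      Reads (arr σ 0) (reg σ 5) (map toℕ xs ++ rest) →
      ∃[ τ ] Exec W (while 8 accumulate) σ (length xs *ℕ 7 +ℕ 1) τ × frame τ ≡ layout L v b o ×
             reg τ 6 ≡ u × arr τ 1 ≡ μ × reg τ 9 ≡ reg σ 9 +ℕ count C xs ×
             Reads (arr τ 0) (reg τ 5) rest
    accumulate-exec [] σ fr u≡ μ≡ row d≡ _ r =
      σ , while-false d≡ , fr , u≡ , μ≡ , sym (ℕ.+-identityʳ (reg σ 9)) , r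
    accumulate-exec {C = C} {μ} (x ∷ xs) σ fr u≡ μ≡ row d≡ s≤ r =
      let τ , run , fr′ , u≡′ , μ≡′ , s≡ , r′ = accumulate-exec {C = C} {μ} xs _ fr u≡ μ≡ row
            (cong₂ _∸_ d≡ one≡)
            (ℕ.≤-trans (ℕ.≤-reflexive (cong (λ c → (reg σ 9 +ℕ c) +ℕ length xs) read≡)) s+bit≤)
            (subst (λ k → Reads (arr σ 0) (reg σ 5 +ℕ k) _) (sym one≡) (reads-next r))
      in τ
       , while-true (λ d≡0 → ℕ.1+n≢0 (trans (sym d≡) d≡0))
           (load ⨾ op (subst (_< W) (sym index≡) (vertex-index b+n≤n² x)) ⨾ load ⨾
            op (≤n⇒<W (ℕ.≤-trans (ℕ.≤-reflexive (cong (reg σ 9 +ℕ_) read≡)) (ℕ.m+n≤o⇒m≤o _ s+bit≤))) ⨾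
            op (subst (λ k → reg σ 5 +ℕ k < W) (sym one≡) (reads-< r)) ⨾
            op (≤n⇒<W (ℕ.≤-trans (ℕ.m∸n≤m (reg σ 8) (reg σ 1))
              (ℕ.≤-trans (ℕ.≤-reflexive d≡) (ℕ.m+n≤o⇒n≤o (reg σ 9) s≤)))))
           run
       , fr′ , u≡′ , μ≡′
       , trans s≡ (trans (cong (λ c → (reg σ 9 +ℕ c) +ℕ count C xs) read≡) (ℕ.+-assoc (reg σ 9) _ _))
       , r′
      where
      one≡ = cong one fr
      index≡ : reg σ 4 +ℕ arr σ 0 (reg σ 5) ≡ b +ℕ toℕ x
      index≡ = cong₂ _+ℕ_ (cong base fr) (reads-head r)
      read≡ : arr σ 1 (reg σ 4 +ℕ arr σ 0 (reg σ 5)) ≡ bit (lookup C x)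
      read≡ = trans (cong (arr σ 1) index≡) (trans (cong (λ f → f (b +ℕ toℕ x)) μ≡) (row x))
      s+bit≤ : (reg σ 9 +ℕ bit (lookup C x)) +ℕ length xs ≤ n
      s+bit≤ = ℕ.≤-trans (ℕ.≤-reflexive (ℕ.+-assoc (reg σ 9) _ _))
        (ℕ.≤-trans (ℕ.+-monoʳ-≤ (reg σ 9) (ℕ.+-monoˡ-≤ (length xs) (bit≤1 (lookup C x)))) s≤)

    -- The lower part protects the reference row at 0, the upper part the zeros on which later
    -- rounds rely.
    Outside : (ℕ → ℕ) → (ℕ → ℕ) → Set
    Outside μ ν = ∀ {j} → j < b ⊎ b +ℕ n ≤ j → ν j ≡ μ j

    outside-update : ∀ {μ a} (u : Fin n) → Outside μ (μ [ b +ℕ toℕ u ↦ a ])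
    outside-update {μ} u out = update-other μ λ { refl → [ ℕ.m+n≮m b (toℕ u)
      , (λ b+n≤ → ℕ.<⇒≱ (ℕ.+-monoʳ-< b (Fin.toℕ<n u)) b+n≤) ]′ out }

    -- The time depends on the degree alone, since the two branches of the test cost the same:
    -- `skip` takes one step just as `store` does. When `u` is the source, its bit is set a second
    -- time, without effect.
    select-exec : ∀ {v o C rest} u σ → frame σ ≡ layout L (toℕ v) b o → reg σ 6 ≡ toℕ u →
      Row b C (arr σ 1) → Reads (arr σ 0) (reg σ 5) (block L u ++ rest) → Prefix G v (toℕ u) C →
      ∃[ τ ] ∃[ C′ ] Exec W select σ (3 +ℕ (degree L u *ℕ 7 +ℕ 1 +ℕ 5)) τ × frame τ ≡ layout L (toℕ v) b o ×
        reg τ 6 ≡ suc (toℕ u) × reg τ 7 ≡ n ∸ suc (toℕ u) × Row b C′ (arr τ 1) ×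
        Outside (arr σ 1) (arr τ 1) × Reads (arr τ 0) (reg τ 5) rest × Prefix G v (suc (toℕ u)) C′
    select-exec {v} {o} {C} {rest} u σ fr u≡ row r P = finish (reg τ 9 ℕ.≟ 0)
      where
      σ′ = setReg 9 0 (setReg 5 (reg σ 5 +ℕ reg σ 1) (setReg 8 (arr σ 0 (reg σ 5)) σ))
      r′ : Reads (arr σ′ 0) (reg σ′ 5) (map toℕ (nbrs L u) ++ rest)
      r′ = subst (λ k → Reads (arr σ 0) (reg σ 5 +ℕ k) _) (sym (cong one fr)) (reads-next r)
      scan = accumulate-exec {C = C} (nbrs L u) σ′ fr u≡ refl row (reads-head r) (degree≤n L u) r′
      τ = proj₁ scan
      run = proj₁ (proj₂ scan)
      fr′ = proj₁ (proj₂ (proj₂ scan))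
      u≡′ = proj₁ (proj₂ (proj₂ (proj₂ scan)))
      μ≡ = proj₁ (proj₂ (proj₂ (proj₂ (proj₂ scan))))
      s≡ = proj₁ (proj₂ (proj₂ (proj₂ (proj₂ (proj₂ scan)))))
      r″ = proj₂ (proj₂ (proj₂ (proj₂ (proj₂ (proj₂ scan)))))
      index≡ : reg τ 4 +ℕ reg τ 6 ≡ b +ℕ toℕ u
      index≡ = cong₂ _+ℕ_ (cong base fr′) u≡′
      next≡ : reg τ 6 +ℕ reg τ 1 ≡ suc (toℕ u)
      next≡ = trans (cong₂ _+ℕ_ u≡′ (cong one fr′)) (ℕ.+-comm (toℕ u) 1)
      left≡ : reg τ 0 ∸ (reg τ 6 +ℕ reg τ 1) ≡ n ∸ suc (toℕ u)
      left≡ = cong₂ _∸_ (cong size fr′) next≡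
      index<W = subst (_< W) (sym index≡) (vertex-index b+n≤n² u)
      next<W = subst (_< W) (sym next≡) (≤n⇒<W (Fin.toℕ<n u))
      left<W = subst (_< W) (sym left≡) (≤n⇒<W (ℕ.m∸n≤m n (suc (toℕ u))))
      5<W = subst (λ k → reg σ 5 +ℕ k < W) (sym (cong one fr)) (reads-< r)
      finish : _ → _
      finish (no s≢0) with y , y∈ , y∈C ← count≢0 {C = C} (nbrs L u) (s≢0 ∘ trans s≡) =
        _ , C , load ⨾ op 5<W ⨾ const 0<W ⨾ run ⨾ op index<W ⨾ ifNZ-true s≢0 skip ⨾ op next<W ⨾ op left<W
        , fr′ , next≡ , left≡ , subst (Row b C) (sym μ≡) row
        , (λ {j} _ → cong (λ f → f j) μ≡) , r″ , prefix-skip G y∈C (symm G (to (correct L u y) y∈)) P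
      finish (yes s≡0) =
        _ , C ∪ ⁅ u ⁆ , load ⨾ op 5<W ⨾ const 0<W ⨾ run ⨾ op index<W ⨾ ifNZ-false s≡0 store ⨾ op next<W ⨾ op left<W
        , fr′ , next≡ , left≡
        , subst (Row b (C ∪ ⁅ u ⁆)) (sym stored≡) (row-insert {μ = arr σ 1} {C} u row)
        , (λ {j} out → trans (cong (λ f → f j) stored≡) (outside-update {arr σ 1} u out))
        , r″ , prefix-insert G (λ {y} y∈C yu → count≡0 {C = C} (trans (sym s≡) s≡0) (from (correct L u y) (symm G yu)) y∈C) P
        where
        stored≡ : arr τ 1 [ reg τ 4 +ℕ reg τ 6 ↦ reg τ 1 ] ≡ arr σ 1 [ b +ℕ toℕ u ↦ 1 ]
        stored≡ rewrite index≡ | μ≡ | cong one fr′ = refl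

    -- `tabulate g` is the part of `allFin n` from vertex `a` on. Its tail is `tabulate (g ∘ suc)`
    -- by computation, so input, time and invariant advance together.
    select-loop : ∀ {v o} k (g : Fin k → Fin n) {a C} σ → (∀ j → toℕ (g j) ≡ a +ℕ toℕ j) → a +ℕ k ≡ n →
      frame σ ≡ layout L (toℕ v) b o → reg σ 6 ≡ a → reg σ 7 ≡ k → Row b C (arr σ 1) →
      Reads (arr σ 0) (reg σ 5) (concatMap (block L) (tabulate g)) → Prefix G v a C →
      ∃[ τ ] ∃[ C′ ] Exec W (while 7 select) σ (selectTime L (tabulate g)) τ × frame τ ≡ layout L (toℕ v) b o ×
        Row b C′ (arr τ 1) × Outside (arr σ 1) (arr τ 1) × Prefix G v n C′
    select-loop {v} zero g {a} {C} σ g≡ a+k≡n fr u≡ k≡ row r P =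
      σ , C , while-false k≡ , fr , row , (λ _ → refl)
        , subst (λ a → Prefix G v a C) (trans (sym (ℕ.+-identityʳ a)) a+k≡n) P
    select-loop {v} (suc k) g {a} {C} σ g≡ a+k≡n fr u≡ k≡ row r P =
      let τ , C₁ , run , fr′ , u≡′ , k≡′ , row′ , out , r′ , P′ =
            select-exec {v} {C = C} (g zero) σ fr (trans u≡ (sym g0≡)) row r (subst (λ a → Prefix G v a C) (sym g0≡) P)
          υ , C₂ , runs , fr″ , row″ , out′ , P″ =
            select-loop {v} k (g ∘ suc) {suc a} {C₁} τ (λ j → trans (g≡ (suc j)) (ℕ.+-suc a (toℕ j)))
              1+a+k≡n fr′ (trans u≡′ (cong suc g0≡))
              (trans k≡′ (trans (cong (λ a → n ∸ suc a) g0≡)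
                (trans (cong (_∸ suc a) (sym 1+a+k≡n)) (ℕ.m+n∸m≡n (suc a) k))))
              row′ r′ (subst (λ a → Prefix G v (suc a) C₁) g0≡ P′)
      in υ , C₂ , while-true (λ k≡0 → ℕ.1+n≢0 (trans (sym k≡) k≡0)) run runs , fr″ , row″
           , (λ j∉ → trans (out′ j∉) (out j∉)) , P″
      where
      g0≡ : toℕ (g zero) ≡ a
      g0≡ = trans (g≡ zero) (ℕ.+-identityʳ a)
      1+a+k≡n : suc a +ℕ k ≡ n
      1+a+k≡n = trans (sym (ℕ.+-suc a k)) a+k≡n

    greedy-exec : ∀ v {o} σ → frame σ ≡ layout L (toℕ v) b o → (∀ {j} → b ≤ j → arr σ 1 j ≡ 0) →
      ∃[ τ ] ∃[ C ] Exec W greedy σ (greedyTime L) τ × frame τ ≡ layout L (toℕ v) b o ×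
        Row b C (arr τ 1) × Outside (arr σ 1) (arr τ 1) × GreedyFrom G v C
    greedy-exec v σ fr fresh =
      let τ , C , runs , fr′ , row , out , P = select-loop {v} n id {0} {⊥ ∪ ⁅ v ⁆} σ′ (λ _ → refl) refl fr refl
            (cong size fr)
            (subst (Row b (⊥ ∪ ⁅ v ⁆)) (sym stored≡) (row-insert {μ = arr σ 1} {⊥} v
              (λ x → trans (fresh (ℕ.m≤m+n b (toℕ x))) (sym (bit-∉ {C = ⊥} {x} ∉⊥)))))
            (subst (λ μ → Reads μ 1 (concatMap (block L) (allFin n))) (sym (cong input fr)) reads-input)
            (prefix-start G v)
      in τ , C
       , op (subst (_< W) (sym index≡) (vertex-index b+n≤n² v)) ⨾ store ⨾ const 1<W ⨾ const 0<W
         ⨾ op (≤n⇒<W (ℕ.≤-reflexive (cong size fr))) ⨾ runs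
       , fr′ , row
       , (λ {j} j∉ → trans (out j∉) (trans (cong (λ f → f j) stored≡) (outside-update {arr σ 1} v j∉)))
       , Prefix.source P , prefix-greedy G P
      where
      σ′ = setReg 7 (reg σ 0) (setReg 6 0 (setReg 5 1 (setArr 1 (reg σ 4 +ℕ reg σ 3) (reg σ 1)
             (setReg 10 (reg σ 4 +ℕ reg σ 3) σ))))
      index≡ : reg σ 4 +ℕ reg σ 3 ≡ b +ℕ toℕ v
      index≡ = cong₂ _+ℕ_ (cong base fr) (cong source fr)
      stored≡ : arr σ 1 [ reg σ 4 +ℕ reg σ 3 ↦ reg σ 1 ] ≡ arr σ 1 [ b +ℕ toℕ v ↦ 1 ]
      stored≡ = cong₂ (arr σ 1 [_↦_]) index≡ (cong one fr)

    -- `C` and `D` are the tails, from position `a` on, of the current row and the reference row;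
    -- `difference` then unfolds one entry per iteration.
    report-loop : ∀ {v k o a} (C D : Subset k) σ → frame σ ≡ layout L v b o →
      reg σ 6 ≡ a → reg σ 7 ≡ k → a +ℕ k ≡ n →
      (∀ j → arr σ 1 (b +ℕ (a +ℕ toℕ j)) ≡ bit (lookup C j)) → (∀ j → arr σ 1 (a +ℕ toℕ j) ≡ bit (lookup D j)) →
      ∃[ τ ] Exec W (while 7 report) σ (k *ℕ 11 +ℕ 1) τ × arr τ 1 ≡ arr σ 1 ×
             frame τ ≡ layout L v b (o ++ concatMap encodeℤ (Vec.toList (difference C D)))
    report-loop {v} {o = o} [] [] σ fr u≡ k≡ _ _ _ =
      σ , while-false k≡ , refl , trans fr (cong (layout L v b) (sym (List.++-identityʳ o)))
    report-loop {v} {suc k} {o} {a} (c ∷ C) (d ∷ D) σ fr u≡ k≡ a+k≡n rowC rowD =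
      let τ , runs , μ≡ , fr′ = report-loop {v} {k} {o ++ encodeℤ (coefficient c d)} {suc a} C D σ′ printed
            next≡ (trans (cong₂ _∸_ (cong size fr) next≡) left≡) 1+a+k≡n
            (λ j → trans (cong (λ i → arr σ 1 (b +ℕ i)) (sym (ℕ.+-suc a (toℕ j)))) (rowC (suc j)))
            (λ j → trans (cong (arr σ 1) (sym (ℕ.+-suc a (toℕ j)))) (rowD (suc j)))
      in τ
       , while-true (λ k≡0 → ℕ.1+n≢0 (trans (sym k≡) k≡0))
           (op (subst (_< W) (sym index≡) index<W) ⨾ load ⨾ load ⨾
            op (small (ℕ.m∸n≤m D₀ C₀) D₀≤1) ⨾ op (small (ℕ.m∸n≤m C₀ D₀) C₀≤1) ⨾
            op (subst (_< W) (cong₂ (λ c d → (d ∸ c) +ℕ (c ∸ d)) (sym C₀≡) (sym D₀≡)) (abs<W c d)) ⨾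
            print ⨾ print ⨾ op (subst (_< W) (sym next≡) (≤n⇒<W (ℕ.m+n≤o⇒m≤o (suc a) (ℕ.≤-reflexive 1+a+k≡n)))) ⨾
            op (≤n⇒<W (ℕ.≤-trans (ℕ.m∸n≤m (reg σ 0) (reg σ 6 +ℕ reg σ 1)) (ℕ.≤-reflexive (cong size fr)))))
           runs
       , μ≡
       , trans fr′ (cong (layout L v b) (List.++-assoc o _ _))
      where
      C₀ D₀ : ℕ
      C₀ = arr σ 1 (reg σ 4 +ℕ reg σ 6)
      D₀ = arr σ 1 (reg σ 6)
      σ′ = setReg 7 (reg σ 0 ∸ (reg σ 6 +ℕ reg σ 1)) (setReg 6 (reg σ 6 +ℕ reg σ 1)
             (emit ((D₀ ∸ C₀) +ℕ (C₀ ∸ D₀)) (emit (D₀ ∸ C₀)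
               (setReg 9 ((D₀ ∸ C₀) +ℕ (C₀ ∸ D₀)) (setReg 9 (C₀ ∸ D₀) (setReg 8 (D₀ ∸ C₀)
                 (setReg 11 D₀ (setReg 10 C₀ (setReg 10 (reg σ 4 +ℕ reg σ 6) σ)))))))))
      1+a+k≡n : suc a +ℕ k ≡ n
      1+a+k≡n = trans (sym (ℕ.+-suc a k)) a+k≡n
      left≡ : n ∸ suc a ≡ k
      left≡ = trans (cong (_∸ suc a) (sym 1+a+k≡n)) (ℕ.m+n∸m≡n (suc a) k)
      next≡ : reg σ 6 +ℕ reg σ 1 ≡ suc a
      next≡ = trans (cong₂ _+ℕ_ u≡ (cong one fr)) (ℕ.+-comm a 1)
      index≡ : reg σ 4 +ℕ reg σ 6 ≡ b +ℕ (a +ℕ 0)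
      index≡ = cong₂ _+ℕ_ (cong base fr) (trans u≡ (sym (ℕ.+-identityʳ a)))
      index<W : b +ℕ (a +ℕ 0) < W
      index<W = ≤n²⇒<W (ℕ.≤-trans (ℕ.+-monoʳ-≤ b (ℕ.≤-trans (ℕ.+-monoʳ-≤ a z≤n) (ℕ.≤-reflexive a+k≡n))) b+n≤n²)
      C₀≡ : C₀ ≡ bit c
      C₀≡ = trans (cong (arr σ 1) index≡) (rowC zero)
      D₀≡ : D₀ ≡ bit d
      D₀≡ = trans (cong (arr σ 1) (trans u≡ (sym (ℕ.+-identityʳ a)))) (rowD zero)
      C₀≤1 : C₀ ≤ 1
      C₀≤1 = ℕ.≤-trans (ℕ.≤-reflexive C₀≡) (bit≤1 c)
      D₀≤1 : D₀ ≤ 1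
      D₀≤1 = ℕ.≤-trans (ℕ.≤-reflexive D₀≡) (bit≤1 d)
      small : ∀ {x y} → x ≤ y → y ≤ 1 → x < W
      small x≤y y≤1 = ℕ.≤-<-trans (ℕ.≤-trans x≤y y≤1) 1<W
      abs<W : ∀ c d → (bit d ∸ bit c) +ℕ (bit c ∸ bit d) < W
      abs<W true  true  = 0<W
      abs<W true  false = 1<W
      abs<W false true  = 1<W
      abs<W false false = 0<W
      printed : frame σ′ ≡ layout L v b (o ++ encodeℤ (coefficient c d))
      printed = trans (cong (λ f → record f { output = (output f ++ D₀ ∸ C₀ ∷ []) ++ (D₀ ∸ C₀) +ℕ (C₀ ∸ D₀) ∷ [] }) fr)
        (cong (layout L v b) (trans (List.++-assoc o _ _) (cong (o ++_)
          (trans (cong₂ (λ c d → d ∸ c ∷ (d ∸ c) +ℕ (c ∸ d) ∷ []) C₀≡ D₀≡) (sym (encode-coefficient c d))))))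

  -- The new base has the form `n +ℕ b` because for `b = v *ℕ n` this is `suc v *ℕ n` by
  -- computation.
  advance-exec : ∀ {v b o} σ → v < n → b +ℕ n ≤ n *ℕ n → frame σ ≡ layout L v b o →
    ∃[ τ ] Exec W advance σ 3 τ × frame τ ≡ layout L (suc v) (n +ℕ b) o ×
           reg τ 2 ≡ n ∸ suc v × arr τ 1 ≡ arr σ 1
  advance-exec {v} {b} {o} σ v<n b+n≤n² fr = _
    , op (subst (_< W) (sym base≡) (≤n²⇒<W (ℕ.≤-trans (ℕ.≤-reflexive (ℕ.+-comm n b)) b+n≤n²)))
      ⨾ op (subst (_< W) (sym source≡) (≤n⇒<W v<n))
      ⨾ op (≤n⇒<W (ℕ.≤-trans (ℕ.m∸n≤m (reg σ 0) (reg σ 3 +ℕ reg σ 1)) (ℕ.≤-reflexive (cong size fr))))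
    , trans (cong₂ (λ v b → record (frame σ) { source = v ; base = b }) source≡ base≡)
            (cong (λ f → record f { source = suc v ; base = n +ℕ b }) fr)
    , cong₂ _∸_ (cong size fr) source≡
    , refl
    where
    base≡ : reg σ 4 +ℕ reg σ 0 ≡ n +ℕ b
    base≡ = trans (cong₂ _+ℕ_ (cong base fr) (cong size fr)) (ℕ.+-comm b n)
    source≡ : reg σ 3 +ℕ reg σ 1 ≡ suc v
    source≡ = trans (cong₂ _+ℕ_ (cong source fr) (cong one fr)) (ℕ.+-comm v 1)

  row-fits : ∀ {a} → a < n → a *ℕ n +ℕ n ≤ n *ℕ n
  row-fits {a} a<n = ℕ.≤-trans (ℕ.≤-reflexive (ℕ.+-comm (a *ℕ n) n)) (ℕ.*-monoˡ-≤ n a<n)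

  round-exec : ∀ v {o C₀} σ → 0 < toℕ v → frame σ ≡ layout L (toℕ v) (toℕ v *ℕ n) o → Row 0 C₀ (arr σ 1) →
    (∀ {j} → toℕ v *ℕ n ≤ j → arr σ 1 j ≡ 0) →
    ∃[ τ ] ∃[ C ] Exec W round σ (roundTime L) τ ×
      frame τ ≡ layout L (suc (toℕ v)) (suc (toℕ v) *ℕ n) (o ++ concatMap encodeℤ (Vec.toList (difference C C₀))) ×
      reg τ 2 ≡ n ∸ suc (toℕ v) × Row 0 C₀ (arr τ 1) ×
      (∀ {j} → suc (toℕ v) *ℕ n ≤ j → arr τ 1 j ≡ 0) × GreedyFrom G v C
  round-exec v {o} {C₀} σ 0<v fr row₀ fresh =
    let b+n≤n² = row-fits (Fin.toℕ<n v)
        τ , C , run , fr₁ , rowC , outside , from-v = greedy-exec b+n≤n² v σ fr fresh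
        -- As `v` is positive, its row starts at cell n or later, beyond the whole reference row.
        row₀′ = λ x → trans (outside (inj₁ (ℕ.<-≤-trans (Fin.toℕ<n x) (ℕ.m≤n*m n (toℕ v) {{>-nonZero 0<v}})))) (row₀ x)
        υ , printing , μ≡ , fr₂ = report-loop b+n≤n² {toℕ v} {n} {o} {0} C C₀ (setReg 7 (reg τ 0) (setReg 6 0 τ)) fr₁ refl
          (cong size fr₁) refl rowC row₀′
        φ , advancing , fr₃ , left≡ , μ≡′ = advance-exec υ (Fin.toℕ<n v) b+n≤n² fr₂
        μ≡″ = trans μ≡′ μ≡
    in φ , C
     , run ⨾ const 0<W ⨾ op (≤n⇒<W (ℕ.≤-reflexive (cong size fr₁))) ⨾ printing ⨾ advancing
     , fr₃ , left≡
     , subst (Row 0 C₀) (sym μ≡″) row₀′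
     , (λ {j} le → trans (cong (λ f → f j) μ≡″)
         (trans (outside (inj₂ (ℕ.≤-trans (ℕ.≤-reflexive (ℕ.+-comm (toℕ v *ℕ n) n)) le)))
           (fresh (ℕ.≤-trans (ℕ.m≤n+m (toℕ v *ℕ n) n) le))))
     , from-v

  rounds-exec : ∀ k (g : Fin k → Fin n) {a o C₀} σ → (∀ j → toℕ (g j) ≡ a +ℕ toℕ j) → a +ℕ k ≡ n → 0 < a →
    frame σ ≡ layout L a (a *ℕ n) o → reg σ 2 ≡ k → Row 0 C₀ (arr σ 1) →
    (∀ {j} → a *ℕ n ≤ j → arr σ 1 j ≡ 0) →
    ∃[ τ ] Σ[ Cs ∈ (Fin k → Subset n) ] Exec W (while 2 round) σ (roundsTime L k) τ ×
      out τ ≡ o ++ encodeSystem (tabulate (λ j → difference (Cs j) C₀)) ×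
      (∀ j → GreedyFrom G (g j) (Cs j))
  rounds-exec zero g {o = o} σ _ _ _ fr k≡ _ _ =
    σ , (λ ()) , while-false k≡ , trans (cong output fr) (sym (List.++-identityʳ o)) , (λ ())
  rounds-exec (suc k) g {a} {o} {C₀} σ g≡ a+k≡n 0<a fr k≡ row₀ fresh
    -- Identifies `a` with the index of the vertex `g zero`, the form in which `round-exec` is
    -- stated.
    with refl ← trans (g≡ zero) (ℕ.+-identityʳ a) =
    let τ , C , run , fr′ , left≡ , row₀′ , fresh′ , from-g0 = round-exec (g zero) {o} {C₀} σ 0<a fr row₀ fresh
        1+a+k≡n = trans (sym (ℕ.+-suc a k)) a+k≡n
        υ , Cs , runs , out≡ , from-g = rounds-exec k (g ∘ suc) {suc a} {C₀ = C₀} τ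
          (λ j → trans (g≡ (suc j)) (ℕ.+-suc a (toℕ j))) 1+a+k≡n (s≤s z≤n) fr′
          (trans left≡ (trans (cong (_∸ suc a) (sym 1+a+k≡n)) (ℕ.m+n∸m≡n (suc a) k))) row₀′ fresh′
    in υ , C Vector.∷ Cs
     , while-true (λ k≡0 → ℕ.1+n≢0 (trans (sym k≡) k≡0)) run runs
     , trans out≡ (List.++-assoc o _ _)
     , λ { zero → from-g0 ; (suc j) → from-g j }

-- Correctness of the printed system

satisfies-differences : ∀ {n k} (w : Fin n → ℝ) (Cs : Fin k → Subset n) C₀ →
  All (w Satisfies_) (toSystem (tabulate (λ j → difference (Cs j) C₀))) ⇔ (∀ j → weight w (Cs j) ≈ weight w C₀)
satisfies-differences {n} {k} w Cs C₀ = mk⇔ forth back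
  where
  unwrap : All (w Satisfies_) (toSystem (tabulate (λ j → difference (Cs j) C₀))) →
    ∀ j → w Satisfies equation (difference (Cs j) C₀)
  unwrap satisfied = All.tabulate⁻ {P = λ a → w Satisfies equation a} {f = λ j → difference (Cs j) C₀}
    (All.map⁻ {P = w Satisfies_} {f = equation} satisfied)
  wrap : (∀ j → w Satisfies equation (difference (Cs j) C₀)) →
    All (w Satisfies_) (toSystem (tabulate (λ j → difference (Cs j) C₀)))
  wrap each = All.map⁺ {P = w Satisfies_} {f = equation}
    (All.tabulate⁺ {P = λ a → w Satisfies equation a} {f = λ j → difference (Cs j) C₀} each)
  forth : All (w Satisfies_) (toSystem (tabulate (λ j → difference (Cs j) C₀))) → ∀ j → weight w (Cs j) ≈ weight w C₀
  forth satisfied j = to (satisfies-difference w (Cs j) C₀) (unwrap satisfied j)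
  back : (∀ j → weight w (Cs j) ≈ weight w C₀) → All (w Satisfies_) (toSystem (tabulate (λ j → difference (Cs j) C₀)))
  back equal = wrap (λ j → from (satisfies-difference w (Cs j) C₀) (equal j))

-- Necessity holds because greedy sets are maximal independent. For sufficiency, any two maximal
-- independent sets are compared through `C₀`.
greedy-system : ∀ {k} {G : Graph (suc k)} → IsCograph G → ∀ {C₀} {Cs : Fin k → Subset (suc k)} →
  GreedyFrom G zero C₀ → (∀ j → GreedyFrom G (suc j) (Cs j)) →
  WellCoveringSystem G (toSystem (tabulate (λ j → difference (Cs j) C₀)))
greedy-system {k} {G} cograph {C₀} {Cs} (0∈C₀ , g₀) gs w = mk⇔
  (λ covered → from (satisfies-differences w Cs C₀) (λ j →
    covered (Cs j) C₀ (greedy-maximal G (proj₂ (gs j))) (greedy-maximal G g₀)))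
  (λ satisfied I J I-max J-max → let equal = to (satisfies-differences w Cs C₀) satisfied in
    ≈-trans {weight w I} {weight w C₀} {weight w J} (determined equal I-max)
      (≈-sym {weight w J} {weight w C₀} (determined equal J-max)))
  where
  family : (∀ j → weight w (Cs j) ≈ weight w C₀) → GreedyFamily G w ⊤ C₀
  family _     {zero}  _ = C₀ , 0∈C₀ , g₀ , ≈-reflexive {weight w C₀} refl
  family equal {suc j} _ = Cs j , proj₁ (gs j) , proj₂ (gs j) , equal j
  determined : (∀ j → weight w (Cs j) ≈ weight w C₀) → ∀ {I} → MaximalIndependent G I → weight w I ≈ weight w C₀
  determined equal {I} I-max = greedy-family-determines G w {C₀ = C₀} {I} (cograph-cotree cograph)
    -- Vertex 0 has the least index, so the set grown from it is the plain greedy set required as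
    -- reference.
    (least-first G (λ _ → z≤n) g₀) (family equal) (maximal-greedy G I-max)

construction-nonempty : ∀ {n} → Construction n → 0 < n
construction-nonempty vertex              = s≤s z≤n
construction-nonempty (union {m} {n} s _) = ℕ.<-≤-trans (construction-nonempty s) (ℕ.m≤m+n m n)
construction-nonempty (complement t)      = construction-nonempty t

-- The summand in `expand` is (n + 1)³ - (n² + n + 2) for n = k + 1, a polynomial in `k` with
-- nonnegative coefficients.
word-size : ∀ k → suc (suc k +ℕ suc k *ℕ suc k) < suc (suc k) ^ 3
word-size k = subst (suc (suc (suc k +ℕ suc k *ℕ suc k)) ≤_) (expand k) (ℕ.m≤m+n _ _)
  where
  open ℕ-Solver
  expand : ∀ k →
    suc (suc (suc k +ℕ suc k *ℕ suc k)) +ℕ (4 +ℕ 9 *ℕ k +ℕ 5 *ℕ (k *ℕ k) +ℕ k *ℕ (k *ℕ k)) ≡ suc (suc k) ^ 3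
  expand = solve 1 (λ k → con 2 :+ ((con 1 :+ k) :+ (con 1 :+ k) :* (con 1 :+ k)) :+
    (con 4 :+ con 9 :* k :+ con 5 :* (k :* k) :+ k :* (k :* k)) := (con 2 :+ k) :^ 3) refl

theorem4p1 : ∃[ p ] ∃[ c ] ∃[ d ]
    (∀ {n : ℕ} (G : Graph n) → IsCograph G → (L : AdjacencyLists G) →
    ∃[ t ] ∃[ σ ] ∃[ S ]
    ( Exec (suc n ^ d) p (initial (encodeGraph L)) t σ
    × t ≤ c *ℕ (n *ℕ (n +ℕ ∣E∣ G))
    × out σ ≡ encodeSystem {n} S
    × length S ≤ n ∸ 1
    × WellCoveringSystem G (toSystem S)))
theorem4p1 = wellCoveringProgram , 34 , 3 , computes
  where
  computes : ∀ {n : ℕ} (G : Graph n) → IsCograph G → (L : AdjacencyLists G) →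
    ∃[ t ] ∃[ σ ] ∃[ S ]
    ( Exec (suc n ^ 3) wellCoveringProgram (initial (encodeGraph L)) t σ
    × t ≤ 34 *ℕ (n *ℕ (n +ℕ ∣E∣ G))
    × out σ ≡ encodeSystem {n} S
    × length S ≤ n ∸ 1
    × WellCoveringSystem G (toSystem S))
  computes {zero}  G (t , _) L with () ← construction-nonempty t
  computes {suc k} G cograph L =
    let wide = word-size k
        n≤n² = ℕ.m≤n*m (suc k) (suc k)
        -- All registers and array 1 start at zero, so the first scan finds source 0 and base 0 in
        -- place. It stands before the loop because it produces the reference and no equation, which
        -- leaves n - 1 rounds.
        τ , C₀ , first , fr , row , outside , from-0 =
          greedy-exec L wide {0} n≤n² zero (setReg 1 1 (setReg 0 (suc k) (initial (encodeGraph L)))) refl (λ _ → refl)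
        υ , advancing , fr′ , left≡ , μ≡ = advance-exec L wide τ (s≤s z≤n) n≤n² fr
        φ , Cs , rest , out≡ , from-suc = rounds-exec L wide k suc {1} {C₀ = C₀} υ (λ _ → refl) refl (s≤s z≤n) fr′ left≡
          (subst (Row 0 C₀) (sym μ≡) row)
          (λ {j} le → trans (cong (λ f → f j) μ≡) (outside (inj₂ (ℕ.≤-trans (ℕ.m≤m+n (suc k) 0) le))))
    in _ , φ , tabulate (λ j → difference (Cs j) C₀)
     , load ⨾ const (ℕ.≤-trans (s≤s (s≤s z≤n)) (ℕ.<⇒≤ wide)) ⨾ first ⨾ advancing ⨾ rest
     , time-bound L
     , out≡
     , ℕ.≤-reflexive (List.length-tabulate (λ j → difference (Cs j) C₀))
     , greedy-system cograph from-0 from-suc
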